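{- Let $\lambda$ be a nonzero real number. For all integers $n\ge 0$ and $p\ge -1$, $$\beta_{n,\lambda}^{(p)}=\sum_{k=0}^{n}\frac{\lambda^{k}(1)_{k+1,1/\lambda}}{\binom{p+k+1}{p+1}}\,S_{2,\lambda}(n,k).$$
   Context: For real $\mu$ and $x$: $(x)_{0,\mu}=1$ and $(x)_{n,\mu}=x(x-\mu)(x-2\mu)\cdots(x-(n-1)\mu)$ for $n\ge 1$; thus $(1)_{k+1,1/\lambda}$ is this symbol with $x=1$, $\mu=1/\lambda$. Also $(x)_0=1$, $(x)_n=x(x-1)\cdots(x-n+1)$ for $n\ge1$, and $\langle a\rangle_0=1$, $\langle a\rangle_k=a(a+1)\cdots(a+k-1)$ for $k\ge1$. The degenerate exponential is the formal power series $e_\lambda^x(t)=\sum_{n\ge0}(x)_{n,\lambda}\frac{t^n}{n!}$, with $e_\lambda(t)=e_\lambda^1(t)$. The degenerate Stirling numbers of the second kind $S_{2,\lambda}(n,k)$ ($0\le k\le n$) are defined by $(x)_{n,\lambda}=\sum_{k=0}^{n}S_{2,\lambda}(n,k)(x)_k$ for $n\ge 0$; equivalently $\frac{1}{k!}(e_\lambda(t)-1)^k=\sum_{n\ge k}S_{2,\lambda}(n,k)\frac{t^n}{n!}$. The Gauss hypergeometric series is ${}_2F_1(a,b;c;x)=\sum_{k\ge0}\frac{\langle a\rangle_k\langle b\rangle_k}{\langle c\rangle_k}\frac{x^k}{k!}$. For an integer $p\ge-1$, the generalized degenerate Bernoulli numbers $\beta_{n,\lambda}^{(p)}$ ($n\ge0$)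 are defined by the identity of formal power series in $t$ (note $1-e_\lambda(t)$ has zero constant term) $${}_2F_1\big(1-\lambda,1;p+2;1-e_\lambda(t)\big)=\sum_{n=0}^\infty\beta_{n,\lambda}^{(p)}\frac{t^n}{n!}.$$ -}

module Defs where

open import Algebra.Apartness.Bundles using (HeytingField; HeytingCommutativeRing)
open import Algebra.Bundles using (CommutativeRing; Semiring)
open import Algebra.Definitions using (Invertible)
import Algebra.Apartness.Properties.HeytingCommutativeRing as HeytingProperties
import Algebra.Properties.CommutativeMonoid.Sum as Sum
import Algebra.Properties.Monoid.Mult as Mult
import Algebra.Properties.Semiring.Sum as SemiringSum
open import Data.Empty using (⊥-elim)
open import Data.Fin.Base as Fin using (Fin; toℕ)
open import Data.Integer.Base as ℤ using (ℤ; +_; -[1+_]; -1ℤ; 1ℤ)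
open import Data.Nat.Base as ℕ using (ℕ; zero; suc; _!; NonZero; z≤n; s≤s)
open import Data.Nat.Combinatorics using (_C_; nCk+nC[k+1]≡[n+1]C[k+1])
import Data.Nat.Properties as ℕ
open import Data.Product using (_×_; _,_; proj₁; proj₂; ∃-syntax; uncurry)
open import Data.Sum.Base using (_⊎_; inj₁; inj₂)
open import Function.Base using (_∘_; id)
open import Level using (Level; 0ℓ; _⊔_)
import Relation.Binary.PropositionalEquality as ≡
import Relation.Binary.Reasoning.Setoid as SetoidReasoning
open import Relation.Binary.Structures using (IsEquivalence)
open import Relation.Nullary using (¬_; yes; no)

private variable
  c ℓ₁ ℓ₂ : Level

module HeytingRing (F : HeytingField c ℓ₁ ℓ₂) where
  open HeytingField F using (heytingCommutativeRing)
  open HeytingCommutativeRing heytingCommutativeRing public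
  open CommutativeRing commutativeRing public
    using (ring; semiring; +-commutativeMonoid; +-monoid)
  open import Algebra.Definitions.RawSemiring (Semiring.rawSemiring semiring) public
    using (_^_) renaming (_×_ to _·_)
  open Sum +-commutativeMonoid public
    using (sum; sum-syntax; sum⁺-syntax)

CharacteristicZero : HeytingField c ℓ₁ ℓ₂ → Set ℓ₂
CharacteristicZero F = ∀ n → suc n · 1# # 0#
  where open HeytingRing F

-- The real numbers, as Cauchy sequences of rationals up to the equivalence _≈ℝ_.
-- The relation _#ℝ_ is the constructive form of being distinct; x #ℝ 0ℝ is what
-- is needed to invert x.
module Reals where
  open import Data.Rational.Base hiding (_≃_)
  open import Data.Rational.Properties
  open import Data.Rational.Solver using (module +-*-Solver)
  open import Relation.Binary.PropositionalEquality
    using (_≡_; _≢_; refl; sym; trans; cong; cong₂; module ≡-Reasoning)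
  open +-*-Solver using (solve; _:=_; _:+_; _:*_; _:-_; :-_; con)

  private
    0<½ : 0ℚ < ½
    0<½ = positive⁻¹ ½

    *-pos : ∀ {p q} → 0ℚ < p → 0ℚ < q → 0ℚ < p * q
    *-pos {p} {q} 0<p 0<q =
      positive⁻¹ (p * q) {{pos*pos⇒pos p {{positive 0<p}} q {{positive 0<q}}}}

    inverse : ∀ p → 0ℚ < p → ∃[ q ] (0ℚ < q × p * q ≡ 1ℚ)
    inverse p 0<p =
      1/ p , positive⁻¹ (1/ p) {{1/pos⇒pos p {{positive 0<p}}}} , *-inverseʳ p
      where instance _ = pos⇒nonZero p {{positive 0<p}}

    *-mono-≤-nonNeg : ∀ {p q r s} → 0ℚ ≤ r → 0ℚ ≤ q → p ≤ q → r ≤ s → p * r ≤ q * s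
    *-mono-≤-nonNeg {p} {q} {r} {s} 0≤r 0≤q p≤q r≤s =
      ≤-trans (*-monoʳ-≤-nonNeg r {{nonNegative 0≤r}} p≤q)
              (*-monoˡ-≤-nonNeg q {{nonNegative 0≤q}} r≤s)

    ≤-move : ∀ {p q r} → p + q ≤ r + q → p ≤ r
    ≤-move {p} {q} {r} h = subst₂-≤ (cancel p q) (cancel r q) (+-monoˡ-≤ (- q) h)
      where
      cancel : ∀ a b → (a + b) + - b ≡ a
      cancel = solve 2 (λ a b → (a :+ b) :+ (:- b) := a) refl
      subst₂-≤ : ∀ {a b c d} → a ≡ b → c ≡ d → a ≤ c → b ≤ d
      subst₂-≤ refl refl = id

    ∣p-p∣≡0 : ∀ p → ∣ p - p ∣ ≡ 0ℚ
    ∣p-p∣≡0 p = cong ∣_∣ (+-inverseʳ p)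

    ∣p-q∣≡∣q-p∣ : ∀ p q → ∣ p - q ∣ ≡ ∣ q - p ∣
    ∣p-q∣≡∣q-p∣ p q =
      trans (cong ∣_∣ (solve 2 (λ a b → a :- b := :- (b :- a)) refl p q)) (∣-p∣≡∣p∣ (q - p))

    ∣p∣≤∣q∣+∣p-q∣ : ∀ p q → ∣ p ∣ ≤ ∣ q ∣ + ∣ p - q ∣
    ∣p∣≤∣q∣+∣p-q∣ p q = ≤-trans
      (≤-reflexive (cong ∣_∣ (solve 2 (λ a b → a := b :+ (a :- b)) refl p q)))
      (∣p+q∣≤∣p∣+∣q∣ q (p - q))

    near : ∀ {p q} → q + q ≡ ∣ p ∣ → ∀ r → ∣ r - p ∣ ≤ q → q ≤ ∣ r ∣
    near {p} {q} q+q≡∣p∣ r h = ≤-move (≤-trans (≤-reflexive q+q≡∣p∣)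
      (≤-trans (∣p∣≤∣q∣+∣p-q∣ p r)
        (+-monoʳ-≤ ∣ r ∣ (≤-trans (≤-reflexive (∣p-q∣≡∣q-p∣ p r)) h))))

    near-cancel : ∀ {B K p q} → 0ℚ < B → B * K ≡ 1ℚ → q + q ≡ ∣ p ∣ → ∀ d e →
                  ∣ d * e - p ∣ ≤ q → ∣ e ∣ ≤ B → K * q ≤ ∣ d ∣
    near-cancel {B} {K} {p} {q} 0<B BK≡1 q+q≡∣p∣ d e h k = *-cancelˡ-≤-pos B {{positive 0<B}} (begin
      B * (K * q)    ≡⟨ *-assoc B K q ⟨
      B * K * q      ≡⟨ cong (_* q) BK≡1 ⟩
      1ℚ * q         ≡⟨ *-identityˡ q ⟩
      q              ≤⟨ near q+q≡∣p∣ (d * e) h ⟩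
      ∣ d * e ∣      ≡⟨ ∣p*q∣≡∣p∣*∣q∣ d e ⟩
      ∣ d ∣ * ∣ e ∣  ≡⟨ *-comm ∣ d ∣ ∣ e ∣ ⟩
      ∣ e ∣ * ∣ d ∣  ≤⟨ *-monoʳ-≤-nonNeg ∣ d ∣ {{∣-∣-nonNeg d}} k ⟩
      B * ∣ d ∣      ∎)
      where open ≤-Reasoning

    half+half : ∀ ε → ½ * ε + ½ * ε ≡ ε
    half+half = solve 1 (λ ε → con ½ :* ε :+ con ½ :* ε := ε) refl

    ⅓ : ℚ
    ⅓ = + 1 / 3

    recip : ℚ → ℚ
    recip p with p ≟ 0ℚ
    ... | yes _   = 0ℚ
    ... | no  p≢0 = (1/ p) {{≢-nonZero p≢0}}

    *-recip : ∀ {p} → p ≢ 0ℚ → p * recip p ≡ 1ℚ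
    *-recip {p} p≢0 with p ≟ 0ℚ
    ... | yes p≡0 = ⊥-elim (p≢0 p≡0)
    ... | no  p≢0 = *-inverseʳ p {{≢-nonZero p≢0}}

    apart⇒≢0 : ∀ {ε p} → 0ℚ < ε → ε ≤ ∣ p ∣ → p ≢ 0ℚ
    apart⇒≢0 0<ε ε≤∣p∣ refl = <-irrefl refl (<-≤-trans 0<ε ε≤∣p∣)

    -- Limits along stage i → ∞: Cauchy sequences are the case I = ℕ × ℕ with the minimum
    -- as stage, null sequences the case I = ℕ.
    module Families {I : Set} (stage : I → ℕ) where

      Eventually : (I → Set) → Set
      Eventually P = ∃[ N ] (∀ i → N ℕ.≤ stage i → P i)

      Vanishing Bounded : (I → ℚ) → Set
      Vanishing d = ∀ ε → 0ℚ < ε → Eventually (λ i → ∣ d i ∣ ≤ ε)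
      Bounded   b = ∃[ B ] (0ℚ < B × Eventually (λ i → ∣ b i ∣ ≤ B))

      both : ∀ {P Q} → Eventually P → Eventually Q → Eventually (λ i → P i × Q i)
      both (M , p) (N , q) = M ℕ.⊔ N , λ i h →
        p i (ℕ.≤-trans (ℕ.m≤m⊔n M N) h) , q i (ℕ.≤-trans (ℕ.m≤n⊔m M N) h)

      map : ∀ {P Q} → (∀ i → P i → Q i) → Eventually P → Eventually Q
      map f (N , p) = N , λ i h → f i (p i h)

      always : ∀ {P} → (∀ i → P i) → Eventually P
      always p = 0 , λ i _ → p i

      vanish-cong : ∀ {d e} → Eventually (λ i → d i ≡ e i) → Vanishing d → Vanishing e
      vanish-cong d≡e vd ε 0<ε =
        map (λ { i (eq , h) → ≤-trans (≤-reflexive (cong ∣_∣ (sym eq))) h })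
            (both d≡e (vd ε 0<ε))

      vanish-0 : Vanishing (λ _ → 0ℚ)
      vanish-0 ε 0<ε = always λ _ → <⇒≤ 0<ε

      vanish-+ : ∀ {d e} → Vanishing d → Vanishing e → Vanishing (λ i → d i + e i)
      vanish-+ {d} {e} vd ve ε 0<ε =
        map (λ { i (h , k) → ≤-trans (∣p+q∣≤∣p∣+∣q∣ (d i) (e i))
                            (≤-trans (+-mono-≤ h k) (≤-reflexive (half+half ε))) })
            (both (vd (½ * ε) 0<h) (ve (½ * ε) 0<h))
        where 0<h = *-pos 0<½ 0<ε

      vanish-neg : ∀ {d} → Vanishing d → Vanishing (λ i → - d i)
      vanish-neg {d} vd ε 0<ε =
        map (λ i → ≤-trans (≤-reflexive (∣-p∣≡∣p∣ (d i)))) (vd ε 0<ε)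

      vanish-* : ∀ {b d} → Bounded b → Vanishing d → Vanishing (λ i → b i * d i)
      vanish-* {b} {d} (B , 0<B , b≤B) vd ε 0<ε with inverse B 0<B
      ... | K , 0<K , BK≡1 =
        map (λ { i (h , k) → ≤-trans (≤-reflexive (∣p*q∣≡∣p∣*∣q∣ (b i) (d i)))
               (≤-trans (*-mono-≤-nonNeg (0≤∣p∣ (d i)) (<⇒≤ 0<B) h k) (≤-reflexive eq)) })
            (both b≤B (vd (K * ε) (*-pos 0<K 0<ε)))
        where
        eq : B * (K * ε) ≡ ε
        eq = trans (sym (*-assoc B K ε)) (trans (cong (_* ε) BK≡1) (*-identityˡ ε))

      bounded-* : ∀ {b c} → Bounded b → Bounded c → Bounded (λ i → b i * c i)
      bounded-* {b} {c} (B , 0<B , b≤B) (K , 0<K , c≤K) =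
        B * K , *-pos 0<B 0<K ,
        map (λ { i (h , k) → ≤-trans (≤-reflexive (∣p*q∣≡∣p∣*∣q∣ (b i) (c i)))
                                     (*-mono-≤-nonNeg (0≤∣p∣ (c i)) (<⇒≤ 0<B) h k) })
            (both b≤B c≤K)

    module Seq = Families {ℕ} id
    module Pair = Families {ℕ × ℕ} (uncurry ℕ._⊓_)

  IsCauchy : (ℕ → ℚ) → Set
  IsCauchy x = ∀ ε → 0ℚ < ε → ∃[ N ] (∀ m n → N ℕ.≤ m → N ℕ.≤ n → ∣ x m - x n ∣ ≤ ε)

  record ℝ : Set where
    constructor mkℝ
    field
      seq      : ℕ → ℚ
      isCauchy : IsCauchy seq
  open ℝ

  infix 4 _≈ℝ_ _#ℝ_

  record _≈ℝ_ (x y : ℝ) : Set where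
    constructor mk≈
    field
      close : ∀ ε → 0ℚ < ε → ∃[ N ] (∀ n → N ℕ.≤ n → ∣ seq x n - seq y n ∣ ≤ ε)
  open _≈ℝ_

  record _#ℝ_ (x y : ℝ) : Set where
    constructor mk#
    field
      gap      : ℚ
      0<gap    : 0ℚ < gap
      eventual : ∃[ N ] (∀ n → N ℕ.≤ n → gap ≤ ∣ seq x n - seq y n ∣)

  private
    toPair : ∀ x → IsCauchy x → Pair.Vanishing (λ i → x (proj₁ i) - x (proj₂ i))
    toPair x c ε 0<ε with c ε 0<ε
    ... | N , h = N , λ { (m , n) N≤ → h m n (ℕ.≤-trans N≤ (ℕ.m⊓n≤m m n))
                                             (ℕ.≤-trans N≤ (ℕ.m⊓n≤n m n)) }

    fromPair : ∀ x → Pair.Vanishing (λ i → x (proj₁ i) - x (proj₂ i)) → IsCauchy x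
    fromPair x v ε 0<ε with v ε 0<ε
    ... | N , h = N , λ m n N≤m N≤n → h (m , n) (ℕ.⊓-glb N≤m N≤n)

    bounded : ∀ x → Seq.Bounded (seq x)
    bounded (mkℝ x c) with c 1ℚ (positive⁻¹ 1ℚ)
    ... | N , h = ∣ x N ∣ + 1ℚ
                , ≤-<-trans (0≤∣p∣ (x N)) (<-respˡ-≡ (+-identityʳ ∣ x N ∣) (+-monoʳ-< ∣ x N ∣ (positive⁻¹ 1ℚ)))
                , N , λ n N≤n → ≤-trans (∣p∣≤∣q∣+∣p-q∣ (x n) (x N))
                                        (+-monoʳ-≤ ∣ x N ∣ (h n N N≤n ℕ.≤-refl))

    boundedˡ : ∀ b → Seq.Bounded b → Pair.Bounded (b ∘ proj₁)
    boundedˡ b (B , 0<B , N , h) =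
      B , 0<B , N , λ { (m , n) N≤ → h m (ℕ.≤-trans N≤ (ℕ.m⊓n≤m m n)) }

    boundedʳ : ∀ b → Seq.Bounded b → Pair.Bounded (b ∘ proj₂)
    boundedʳ b (B , 0<B , N , h) =
      B , 0<B , N , λ { (m , n) N≤ → h n (ℕ.≤-trans N≤ (ℕ.m⊓n≤n m n)) }

    abstract
      +-cauchy : ∀ x y → IsCauchy (λ n → seq x n + seq y n)
      +-cauchy (mkℝ x cx) (mkℝ y cy) = fromPair (λ n → x n + y n) (Pair.vanish-cong
        (Pair.always λ (m , n) → solve 4 (λ a b c d → (a :- b) :+ (c :- d) := (a :+ c) :- (b :+ d))
                                   refl (x m) (x n) (y m) (y n))
        (Pair.vanish-+ (toPair x cx) (toPair y cy)))

      neg-cauchy : ∀ x → IsCauchy (λ n → - seq x n)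
      neg-cauchy (mkℝ x cx) = fromPair (λ n → - x n) (Pair.vanish-cong
        (Pair.always λ (m , n) → solve 2 (λ a b → :- (a :- b) := :- a :- :- b) refl (x m) (x n))
        (Pair.vanish-neg (toPair x cx)))

      *-cauchy : ∀ x y → IsCauchy (λ n → seq x n * seq y n)
      *-cauchy x′@(mkℝ x cx) y′@(mkℝ y cy) = fromPair (λ n → x n * y n) (Pair.vanish-cong
        (Pair.always λ (m , n) →
          solve 4 (λ a b c d → a :* (c :- d) :+ d :* (a :- b) := a :* c :- b :* d)
            refl (x m) (x n) (y m) (y n))
        (Pair.vanish-+ (Pair.vanish-* (boundedˡ x (bounded x′)) (toPair y cy))
                       (Pair.vanish-* (boundedʳ y (bounded y′)) (toPair x cx))))

  fromℚ : ℚ → ℝ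
  fromℚ q = mkℝ (λ _ → q) (λ ε 0<ε → 0 , λ _ _ _ _ → ≤-trans (≤-reflexive (∣p-p∣≡0 q)) (<⇒≤ 0<ε))

  infix  8 -ℝ_
  infixl 7 _*ℝ_
  infixl 6 _+ℝ_

  _+ℝ_ _*ℝ_ : ℝ → ℝ → ℝ
  x +ℝ y = mkℝ (λ n → seq x n + seq y n) (+-cauchy x y)
  x *ℝ y = mkℝ (λ n → seq x n * seq y n) (*-cauchy x y)

  -ℝ_ : ℝ → ℝ
  -ℝ x = mkℝ (λ n → - seq x n) (neg-cauchy x)

  0ℝ 1ℝ : ℝ
  0ℝ = fromℚ 0ℚ
  1ℝ = fromℚ 1ℚ

  private
    pointwise : ∀ {x y} → (∀ n → seq x n ≡ seq y n) → x ≈ℝ y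
    pointwise {x} {y} eq = mk≈ (Seq.vanish-cong
      (Seq.always λ n → sym (trans (cong (_- seq y n) (eq n)) (+-inverseʳ (seq y n))))
      Seq.vanish-0)

    ≈-sym : ∀ {x y} → x ≈ℝ y → y ≈ℝ x
    ≈-sym {x} {y} (mk≈ v) = mk≈ (Seq.vanish-cong
      (Seq.always λ n → solve 2 (λ a b → :- (a :- b) := b :- a) refl (seq x n) (seq y n))
      (Seq.vanish-neg v))

    ≈-trans : ∀ {x y z} → x ≈ℝ y → y ≈ℝ z → x ≈ℝ z
    ≈-trans {x} {y} {z} (mk≈ v) (mk≈ w) = mk≈ (Seq.vanish-cong
      (Seq.always λ n → solve 3 (λ a b c → (a :- b) :+ (b :- c) := a :- c) refl
                          (seq x n) (seq y n) (seq z n))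
      (Seq.vanish-+ v w))

    +-congℝ : ∀ {x y u v} → x ≈ℝ y → u ≈ℝ v → x +ℝ u ≈ℝ y +ℝ v
    +-congℝ {x} {y} {u} {v} (mk≈ p) (mk≈ q) = mk≈ (Seq.vanish-cong
      (Seq.always λ n → solve 4 (λ a b c d → (a :- b) :+ (c :- d) := (a :+ c) :- (b :+ d))
                          refl (seq x n) (seq y n) (seq u n) (seq v n))
      (Seq.vanish-+ p q))

    neg-congℝ : ∀ {x y} → x ≈ℝ y → -ℝ x ≈ℝ -ℝ y
    neg-congℝ {x} {y} (mk≈ p) = mk≈ (Seq.vanish-cong
      (Seq.always λ n → solve 2 (λ a b → :- (a :- b) := :- a :- :- b) refl (seq x n) (seq y n))
      (Seq.vanish-neg p))

    *-congℝ : ∀ {x y u v} → x ≈ℝ y → u ≈ℝ v → x *ℝ u ≈ℝ y *ℝ v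
    *-congℝ {x} {y} {u} {v} (mk≈ p) (mk≈ q) = mk≈ (Seq.vanish-cong
      (Seq.always λ n → solve 4 (λ a b c d → a :* (c :- d) :+ d :* (a :- b) := a :* c :- b :* d)
                          refl (seq x n) (seq y n) (seq u n) (seq v n))
      (Seq.vanish-+ (Seq.vanish-* (bounded x) q) (Seq.vanish-* (bounded v) p)))

    -- For each ε, a Cauchy sequence is eventually at most ε or bounded away from zero.
    dichotomy : ∀ d → IsCauchy d → ∀ ε → 0ℚ < ε →
                Seq.Eventually (λ n → ∣ d n ∣ ≤ ε) ⊎
                ∃[ δ ] (0ℚ < δ × Seq.Eventually (λ n → δ ≤ ∣ d n ∣))
    dichotomy d c ε 0<ε with c (⅓ * ε) (*-pos (positive⁻¹ ⅓) 0<ε)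
    ... | N , h with ∣ d N ∣ ≤? ⅓ * ε + ⅓ * ε
    ... | yes small = inj₁ (N , λ n N≤n → ≤-trans (∣p∣≤∣q∣+∣p-q∣ (d n) (d N))
            (≤-trans (+-mono-≤ small (h n N N≤n ℕ.≤-refl)) (≤-reflexive (thirds ε))))
      where
      thirds : ∀ ε → (⅓ * ε + ⅓ * ε) + ⅓ * ε ≡ ε
      thirds = solve 1 (λ ε → (con ⅓ :* ε :+ con ⅓ :* ε) :+ con ⅓ :* ε := ε) refl
    ... | no large = inj₂ (⅓ * ε , *-pos (positive⁻¹ ⅓) 0<ε , N , λ n N≤n →
            ≤-move (≤-trans (<⇒≤ (≰⇒> large)) (≤-trans (∣p∣≤∣q∣+∣p-q∣ (d N) (d n))
                     (+-monoʳ-≤ ∣ d n ∣ (h N n ℕ.≤-refl N≤n)))))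

    #-irrefl : ∀ {x y} → x ≈ℝ y → ¬ x #ℝ y
    #-irrefl (mk≈ v) (mk# δ 0<δ e)
      with Seq.both e (v (½ * δ) (*-pos 0<½ 0<δ))
    ... | N , h = <-irrefl refl (<-≤-trans ½δ<δ (uncurry ≤-trans (h N ℕ.≤-refl)))
      where
      ½δ<δ : ½ * δ < δ
      ½δ<δ = <-respˡ-≡ (+-identityʳ (½ * δ))
               (<-respʳ-≡ (half+half δ) (+-monoʳ-< (½ * δ) (*-pos 0<½ 0<δ)))

    #-sym : ∀ {x y} → x #ℝ y → y #ℝ x
    #-sym {x} {y} (mk# δ 0<δ e) =
      mk# δ 0<δ (Seq.map (λ n h → ≤-trans h (≤-reflexive (∣p-q∣≡∣q-p∣ (seq x n) (seq y n)))) e)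

    difference : ∀ x y → IsCauchy (λ n → seq x n - seq y n)
    difference x y = isCauchy (x +ℝ -ℝ y)

    #-cotrans : ∀ {x y} → x #ℝ y → ∀ z → x #ℝ z ⊎ z #ℝ y
    #-cotrans {x} {y} (mk# δ 0<δ e) z
      with dichotomy _ (difference x z) (½ * δ) (*-pos 0<½ 0<δ)
    ... | inj₂ (η , 0<η , e′) = inj₁ (mk# η 0<η e′)
    ... | inj₁ small = inj₂ (mk# (½ * δ) (*-pos 0<½ 0<δ)
            (Seq.map (λ { n (h , k) → bound (seq x n) (seq y n) (seq z n) h k }) (Seq.both e small)))
      where
      bound : ∀ a b c → δ ≤ ∣ a - b ∣ → ∣ a - c ∣ ≤ ½ * δ → ½ * δ ≤ ∣ c - b ∣
      bound a b c h k = ≤-move (≤-trans (≤-reflexive (half+half δ)) (≤-trans h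
        (≤-trans (≤-reflexive (cong ∣_∣ (solve 3 (λ a b c → a :- b := (c :- b) :+ (a :- c)) refl a b c)))
        (≤-trans (∣p+q∣≤∣p∣+∣q∣ (c - b) (a - c)) (+-monoʳ-≤ ∣ c - b ∣ k)))))

    #-tight : ∀ x y → ¬ x #ℝ y → x ≈ℝ y
    #-tight x y ¬x#y = mk≈ close′
      where
      close′ : Seq.Vanishing (λ n → seq x n - seq y n)
      close′ ε 0<ε with dichotomy _ (difference x y) ε 0<ε
      ... | inj₁ small            = small
      ... | inj₂ (δ , 0<δ , away) = ⊥-elim (¬x#y (mk# δ 0<δ away))

    module _ (d : ℝ) (δ : ℚ) (0<δ : 0ℚ < δ) (away : Seq.Eventually (λ n → δ ≤ ∣ seq d n ∣)) where

      recip-bounded : Seq.Bounded (λ n → recip (seq d n))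
      recip-bounded with inverse δ 0<δ
      ... | η , 0<η , δη≡1 = η , 0<η , Seq.map (λ n h →
        *-cancelˡ-≤-pos δ {{positive 0<δ}}
          (≤-trans (*-monoʳ-≤-nonNeg ∣ recip (seq d n) ∣ {{∣-∣-nonNeg (recip (seq d n))}} h)
                   (≤-reflexive (trans (sym (∣p*q∣≡∣p∣*∣q∣ (seq d n) (recip (seq d n))))
                     (trans (cong ∣_∣ (*-recip (apart⇒≢0 0<δ h))) (sym δη≡1)))))) away

      recip-difference : ∀ {p q} → p ≢ 0ℚ → q ≢ 0ℚ →
                         - ((recip p * recip q) * (p - q)) ≡ recip p - recip q
      recip-difference {p} {q} p≢0 q≢0 = begin
        - ((recip p * recip q) * (p - q))
          ≡⟨ solve 4 (λ p q r s → :- ((r :* s) :* (p :- q)) := r :* (q :* s) :- (p :* r) :* s)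
               refl p q (recip p) (recip q) ⟩
        recip p * (q * recip q) - (p * recip p) * recip q
          ≡⟨ cong₂ (λ u v → recip p * u - v * recip q) (*-recip q≢0) (*-recip p≢0) ⟩
        recip p * 1ℚ - 1ℚ * recip q
          ≡⟨ cong₂ _-_ (*-identityʳ (recip p)) (*-identityˡ (recip q)) ⟩
        recip p - recip q ∎
        where open ≡-Reasoning

      abstract
        recip-cauchy : IsCauchy (λ n → recip (seq d n))
        recip-cauchy = fromPair (recip ∘ seq d) (Pair.vanish-cong
          (proj₁ away , λ (m , n) N≤ → recip-difference
            (apart⇒≢0 0<δ (proj₂ away m (ℕ.≤-trans N≤ (ℕ.m⊓n≤m m n))))
            (apart⇒≢0 0<δ (proj₂ away n (ℕ.≤-trans N≤ (ℕ.m⊓n≤n m n)))))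
          (Pair.vanish-neg (Pair.vanish-*
            (Pair.bounded-* (boundedˡ (recip ∘ seq d) recip-bounded) (boundedʳ (recip ∘ seq d) recip-bounded))
            (toPair (seq d) (isCauchy d)))))

      recip-inverse : d *ℝ mkℝ (λ n → recip (seq d n)) recip-cauchy ≈ℝ 1ℝ
      recip-inverse = mk≈ (Seq.vanish-cong
        (Seq.map (λ n h → sym (trans (cong (_- 1ℚ) (*-recip (apart⇒≢0 0<δ h))) (+-inverseʳ 1ℚ))) away)
        Seq.vanish-0)

    *-commℝ : ∀ x y → x *ℝ y ≈ℝ y *ℝ x
    *-commℝ x y = pointwise λ n → *-comm (seq x n) (seq y n)

    #⇒invertibleℝ : ∀ {x y} → x #ℝ y → Invertible _≈ℝ_ 1ℝ _*ℝ_ (x +ℝ -ℝ y)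
    #⇒invertibleℝ {x} {y} (mk# δ 0<δ away) =
      d⁻¹ , ≈-trans (*-commℝ d⁻¹ d) d*d⁻¹ , d*d⁻¹
      where
      d     = x +ℝ -ℝ y
      d⁻¹   = mkℝ (λ n → recip (seq d n)) (recip-cauchy d δ 0<δ away)
      d*d⁻¹ = recip-inverse d δ 0<δ away

    invertible⇒#ℝ : ∀ {x y} → Invertible _≈ℝ_ 1ℝ _*ℝ_ (x +ℝ -ℝ y) → x #ℝ y
    invertible⇒#ℝ {x} {y} (z , _ , mk≈ v) =
      let B , 0<B , z≤B = bounded z
          K , 0<K , BK≡1 = inverse B 0<B
      in mk# (K * ½) (*-pos {K} {½} 0<K 0<½)
           (Seq.map (λ n (h , k) → near-cancel {B} {K} {1ℚ} {½} 0<B BK≡1 refl (seq x n - seq y n) (seq z n) h k)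
                    (Seq.both (v ½ 0<½) z≤B))

  ℝ-heytingField : HeytingField 0ℓ 0ℓ 0ℓ
  ℝ-heytingField = record
    { Carrier = ℝ ; _≈_ = _≈ℝ_ ; _#_ = _#ℝ_
    ; _+_ = _+ℝ_ ; _*_ = _*ℝ_ ; -_ = -ℝ_ ; 0# = 0ℝ ; 1# = 1ℝ
    ; isHeytingField = record
      { isHeytingCommutativeRing = record
        { isCommutativeRing = record
          { isRing = record
            { +-isAbelianGroup = record
              { isGroup = record
                { isMonoid = record
                  { isSemigroup = record
                    { isMagma = record { isEquivalence = isEquivalence ; ∙-cong = +-congℝ }
                    ; assoc = λ x y z → pointwise λ n → +-assoc (seq x n) (seq y n) (seq z n)
                    }
                  ; identity = (λ x → pointwise λ n → +-identityˡ (seq x n))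
                             , (λ x → pointwise λ n → +-identityʳ (seq x n))
                  }
                ; inverse = (λ x → pointwise λ n → +-inverseˡ (seq x n))
                          , (λ x → pointwise λ n → +-inverseʳ (seq x n))
                ; ⁻¹-cong = neg-congℝ
                }
              ; comm = λ x y → pointwise λ n → +-comm (seq x n) (seq y n)
              }
            ; *-cong = *-congℝ
            ; *-assoc = λ x y z → pointwise λ n → *-assoc (seq x n) (seq y n) (seq z n)
            ; *-identity = (λ x → pointwise λ n → *-identityˡ (seq x n))
                         , (λ x → pointwise λ n → *-identityʳ (seq x n))
            ; distrib = (λ x y z → pointwise λ n → *-distribˡ-+ (seq x n) (seq y n) (seq z n))
                      , (λ x y z → pointwise λ n → *-distribʳ-+ (seq x n) (seq y n) (seq z n))
            }
          ; *-comm = *-commℝ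
          }
        ; isApartnessRelation = record { irrefl = #-irrefl ; sym = #-sym ; cotrans = #-cotrans }
        ; #⇒invertible = #⇒invertibleℝ
        ; invertible⇒# = invertible⇒#ℝ
        }
      ; tight = λ x y → #-tight x y , #-irrefl
      }
    }
    where
    isEquivalence : IsEquivalence _≈ℝ_
    isEquivalence = record { refl = pointwise (λ _ → refl) ; sym = ≈-sym ; trans = ≈-trans }

  ℝ-characteristicZero : CharacteristicZero ℝ-heytingField
  ℝ-characteristicZero n = mk# 1ℚ (positive⁻¹ 1ℚ) (0 , λ i _ → begin
    1ℚ                              ≤⟨ p≤p+q (0≤seq n i) ⟩
    seq (suc n ·ℝ 1ℝ) i             ≡⟨ 0≤p⇒∣p∣≡p (0≤seq (suc n) i) ⟨
    ∣ seq (suc n ·ℝ 1ℝ) i ∣         ≡⟨ cong ∣_∣ (+-identityʳ (seq (suc n ·ℝ 1ℝ) i)) ⟨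
    ∣ seq (suc n ·ℝ 1ℝ) i - 0ℚ ∣    ∎)
    where
    open HeytingRing ℝ-heytingField using () renaming (_·_ to _·ℝ_)
    open ≤-Reasoning
    p≤p+q : ∀ {p q} → 0ℚ ≤ q → p ≤ p + q
    p≤p+q {p} 0≤q = ≤-trans (≤-reflexive (sym (+-identityʳ p))) (+-monoʳ-≤ p 0≤q)
    0≤seq : ∀ m i → 0ℚ ≤ seq (m ·ℝ 1ℝ) i
    0≤seq zero    i = ≤-refl
    0≤seq (suc m) i = ≤-trans (<⇒≤ (positive⁻¹ 1ℚ)) (p≤p+q (0≤seq m i))

private
  nCk-nonZero : ∀ {n k} → k ℕ.≤ n → NonZero (n C k)
  nCk-nonZero {n}     {zero}  _         = _
  nCk-nonZero {suc n} {suc k} (s≤s k≤n) =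
    ≡.subst NonZero (nCk+nC[k+1]≡[n+1]C[k+1] n k)
      (ℕ.>-nonZero (ℕ.≤-trans (ℕ.>-nonZero⁻¹ (n C k) {{nCk-nonZero k≤n}}) (ℕ.m≤m+n _ _)))

-- The binomial coefficient (p+k+1 choose p+1).  For p ≥ -1 both entries are
-- nonnegative, so taking absolute values is only a cast from ℤ to ℕ.
binomial : ℤ → ℕ → ℕ
binomial p k = ℤ.∣ p ℤ.+ + k ℤ.+ 1ℤ ∣ C ℤ.∣ p ℤ.+ 1ℤ ∣

binomial-nonZero : ∀ {p} → -1ℤ ℤ.≤ p → ∀ k → NonZero (binomial p k)
binomial-nonZero {+ m}          _           k = nCk-nonZero {m ℕ.+ k ℕ.+ 1} {m ℕ.+ 1} (ℕ.+-monoˡ-≤ 1 (ℕ.m≤m+n m k))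
binomial-nonZero { -[1+ zero ]} _           k = nCk-nonZero {n = ℤ.∣ -1ℤ ℤ.+ + k ℤ.+ 1ℤ ∣} z≤n
binomial-nonZero { -[1+ suc n ]} (ℤ.-≤- ()) k

module DegenerateNumbers (F : HeytingField c ℓ₁ ℓ₂) (char0 : CharacteristicZero F) where

  open HeytingRing F public
  open HeytingProperties (HeytingField.heytingCommutativeRing F)
  open Sum +-commutativeMonoid using (sum-cong-≋; ∑-distrib-+)
  open SetoidReasoning setoid

  infixl 7 _/_[_]

  _/_[_] : (x y : Carrier) → y # 0# → Carrier
  x / y [ y#0 ] = x * proj₁ (#⇒invertible y#0)

  fromℕ : ℕ → Carrier
  fromℕ n = n · 1#

  fromℤ : ℤ → Carrier
  fromℤ (+ n)      = fromℕ n
  fromℤ (-[1+ n ]) = - fromℕ (suc n)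

  fromℕ#0 : ∀ n → .{{NonZero n}} → fromℕ n # 0#
  fromℕ#0 (suc n) = char0 n

  -- falling μ x n is (x)_{n,μ}; the ordinary falling factorial (x)_n is the case μ = 1.
  falling : Carrier → Carrier → ℕ → Carrier
  falling μ x zero    = 1#
  falling μ x (suc n) = falling μ x n * (x - fromℕ n * μ)

  rising : Carrier → ℕ → Carrier
  rising a zero    = 1#
  rising a (suc k) = rising a k * (a + fromℕ k)

  rising#0 : ∀ {a} → (∀ i → a + fromℕ i # 0#) → ∀ k → rising a k # 0#
  rising#0 a+i#0 zero    = 1#0
  rising#0 a+i#0 (suc k) = x#0y#0→xy#0 (rising#0 a+i#0 k) (a+i#0 k)

  -- (x)_{n,λ} = ∑_{k≤n} S(n,k) (x)_k for all n and x; values S n k with k > n are unconstrained.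
  IsDegenerateStirling₂ : Carrier → (ℕ → ℕ → Carrier) → Set (c ⊔ ℓ₁)
  IsDegenerateStirling₂ λ′ S =
    ∀ n x → falling λ′ x n ≈ ∑[ k ≤ n ] (S n (toℕ k) * falling 1# x (toℕ k))

  -- f : Series stands for ∑ f(n) tⁿ; there is no factorial in the coefficients.

  Series : Set c
  Series = ℕ → Carrier

  infix  4 _≈ₛ_
  infixl 6 _-ₛ_
  infixl 7 _*ₛ_
  infixr 8 _^ₛ_

  _≈ₛ_ : Series → Series → Set ℓ₁
  f ≈ₛ g = ∀ n → f n ≈ g n

  1ₛ : Series
  1ₛ zero    = 1#
  1ₛ (suc n) = 0#

  _-ₛ_ _*ₛ_ : Series → Series → Series
  (f -ₛ g) n = f n - g n
  (f *ₛ g) n = ∑[ k ≤ n ] (f (toℕ k) * g (n ℕ.∸ toℕ k))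

  _^ₛ_ : Series → ℕ → Series
  f ^ₛ zero  = 1ₛ
  f ^ₛ suc k = f *ₛ f ^ₛ k

  -- f(g(t)) = ∑ₖ fₖ g(t)ᵏ.  As g has no constant term, g(t)ᵏ starts in degree k,
  -- so only the terms with k ≤ n contribute to the coefficient of tⁿ.
  compose : (f g : Series) → g 0 ≈ 0# → Series
  compose f g _ n = ∑[ k ≤ n ] (f (toℕ k) * (g ^ₛ toℕ k) n)

  -- The exponential generating function ∑ aₙ tⁿ/n!.
  egf : (ℕ → Carrier) → Series
  egf a n = a n / fromℕ (n !) [ fromℕ#0 (n !) {{n ℕ.!≢0}} ]

  -- degenerateExp λ x is the series e_λ^x(t).
  degenerateExp : Carrier → Carrier → Series
  degenerateExp λ′ x = egf (falling λ′ x)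

  ₂F₁ : (a b c : Carrier) → (∀ i → c + fromℕ i # 0#) → Series
  ₂F₁ a b c c+i#0 k =
    rising a k * rising b k / rising c k [ rising#0 c+i#0 k ]
      / fromℕ (k !) [ fromℕ#0 (k !) {{k ℕ.!≢0}} ]

  1-e : Carrier → Series
  1-e λ′ = 1ₛ -ₛ degenerateExp λ′ 1#

  1-e-constant : ∀ λ′ → 1-e λ′ 0 ≈ 0#
  1-e-constant λ′ = begin
    1# - 1# * v              ≈⟨ +-congˡ (-‿cong (*-identityˡ v)) ⟩
    1# - v                   ≈⟨ +-congˡ (-‿cong (*-identityʳ v)) ⟨
    1# - v * 1#              ≈⟨ +-congˡ (-‿cong (*-congˡ (trans (x-0≈x (fromℕ 1)) (+-identityʳ 1#)))) ⟨
    1# - v * (fromℕ 1 - 0#)  ≈⟨ +-congˡ (-‿cong (proj₁ (proj₂ (#⇒invertible 1!#0)))) ⟩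
    1# - 1#                  ≈⟨ -‿inverseʳ 1# ⟩
    0#                       ∎
    where
    1!#0 = fromℕ#0 (0 !) {{0 ℕ.!≢0}}
    v    = proj₁ (#⇒invertible 1!#0)

  p+2+i#0 : ∀ {p} → -1ℤ ℤ.≤ p → ∀ i → fromℤ (p ℤ.+ + 2) + fromℕ i # 0#
  p+2+i#0 { + m}           _          i = #-congʳ (Mult.×-homo-+ +-monoid 1# (m ℕ.+ 2) i)
    (fromℕ#0 (m ℕ.+ 2 ℕ.+ i) {{≡.subst (λ j → NonZero (j ℕ.+ i)) (ℕ.+-comm 2 m) _}})
  p+2+i#0 { -[1+ zero ]}   _          i = #-congʳ (Mult.×-homo-+ +-monoid 1# 1 i) (char0 i)
  p+2+i#0 { -[1+ suc n ]} (ℤ.-≤- ()) i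

  -- β is the sequence of generalized degenerate Bernoulli numbers with index p:
  --   ₂F₁(1-λ, 1; p+2; 1-e_λ(t)) = ∑ βₙ tⁿ/n!.
  IsDegenerateBernoulli : Carrier → (p : ℤ) → -1ℤ ℤ.≤ p → (ℕ → Carrier) → Set ℓ₁
  IsDegenerateBernoulli λ′ p -1≤p β =
    compose (₂F₁ (1# - λ′) 1# (fromℤ (p ℤ.+ + 2)) (p+2+i#0 -1≤p)) (1-e λ′) (1-e-constant λ′)
      ≈ₛ egf β

  -- The two defining identities are satisfiable.

  degenerateStirling₂-exists : ∀ λ′ → ∃[ S ] IsDegenerateStirling₂ λ′ S
  degenerateStirling₂-exists λ′ = S , expand
    where
    S : ℕ → ℕ → Carrier
    S zero    zero    = 1#
    S zero    (suc k) = 0#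
    S (suc n) zero    = (0# - fromℕ n * λ′) * S n 0
    S (suc n) (suc k) = S n k + (fromℕ (suc k) - fromℕ n * λ′) * S n (suc k)

    S≈0 : ∀ {n k} → n ℕ.< k → S n k ≈ 0#
    S≈0 {zero}  {suc k} _         = refl
    S≈0 {suc n} {suc k} (s≤s n<k) = begin
      S n k + d * S n (suc k)  ≈⟨ +-cong (S≈0 n<k) (*-congˡ (S≈0 (ℕ.m<n⇒m<1+n n<k))) ⟩
      0# + d * 0#              ≈⟨ +-identityˡ (d * 0#) ⟩
      d * 0#                   ≈⟨ zeroʳ d ⟩
      0#                       ∎
      where d = fromℕ (suc k) - fromℕ n * λ′

    sum-last : ∀ n (g : ℕ → Carrier) →
               ∑[ k ≤ suc n ] g (toℕ k) ≈ ∑[ k ≤ n ] g (toℕ k) + g (suc n)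
    sum-last zero g = begin
      g 0 + (g 1 + 0#)  ≈⟨ +-congˡ (+-identityʳ (g 1)) ⟩
      g 0 + g 1         ≈⟨ +-congʳ (+-identityʳ (g 0)) ⟨
      g 0 + 0# + g 1    ∎
    sum-last (suc n) g = begin
      g 0 + ∑[ k ≤ suc n ] g (suc (toℕ k))                  ≈⟨ +-congˡ (sum-last n (g ∘ suc)) ⟩
      g 0 + (∑[ k ≤ n ] g (suc (toℕ k)) + g (suc (suc n)))  ≈⟨ +-assoc _ _ _ ⟨
      ∑[ k ≤ suc n ] g (toℕ k) + g (suc (suc n))            ∎

    telescope : ∀ a b c → (a - b) + (b - c) ≈ a - c
    telescope a b c = begin
      (a - b) + (b - c)    ≈⟨ +-assoc a (- b) (b - c) ⟩
      a + (- b + (b - c))  ≈⟨ +-congˡ (+-assoc (- b) b (- c)) ⟨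
      a + (- b + b - c)    ≈⟨ +-congˡ (+-congʳ (-‿inverseˡ b)) ⟩
      a + (0# - c)         ≈⟨ +-congˡ (+-identityˡ (- c)) ⟩
      a - c                ∎

    module _ (n : ℕ) (x : Carrier) where
      private
        f = falling 1# x
        μ = fromℕ n * λ′

        g h : ℕ → Carrier
        g k = (fromℕ k - μ) * S n k * f k
        h k = S n k * f (suc k)

      split : ∀ k → S n k * f k * (x - μ) ≈ h k + g k
      split k = begin
        S n k * f k * (x - μ)
          ≈⟨ *-congˡ (telescope x (fromℕ k) μ) ⟨
        S n k * f k * ((x - fromℕ k) + (fromℕ k - μ))
          ≈⟨ distribˡ _ _ _ ⟩
        S n k * f k * (x - fromℕ k) + S n k * f k * (fromℕ k - μ)
          ≈⟨ +-cong (*-assoc _ _ _) (*-comm _ _) ⟩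
        S n k * (f k * (x - fromℕ k)) + (fromℕ k - μ) * (S n k * f k)
          ≈⟨ +-cong (*-congˡ (*-congˡ (+-congˡ (-‿cong (sym (*-identityʳ (fromℕ k)))))))
                    (sym (*-assoc _ _ _)) ⟩
        h k + g k ∎

      g-last : g (suc n) ≈ 0#
      g-last = begin
        (fromℕ (suc n) - μ) * S n (suc n) * f (suc n)
          ≈⟨ *-congʳ (*-congˡ (S≈0 {n} ℕ.≤-refl)) ⟩
        (fromℕ (suc n) - μ) * 0# * f (suc n)  ≈⟨ *-congʳ (zeroʳ _) ⟩
        0# * f (suc n)                        ≈⟨ zeroˡ _ ⟩
        0#                                    ∎

      step : ∑[ k ≤ n ] (S n (toℕ k) * f (toℕ k)) * (x - μ) ≈
             ∑[ k ≤ suc n ] (S (suc n) (toℕ k) * f (toℕ k))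
      step = begin
        ∑[ k ≤ n ] (S n (toℕ k) * f (toℕ k)) * (x - μ)
          ≈⟨ SemiringSum.*-distribʳ-sum semiring _ (λ (k : Fin (suc n)) → S n (toℕ k) * f (toℕ k)) ⟩
        ∑[ k ≤ n ] (S n (toℕ k) * f (toℕ k) * (x - μ))
          ≈⟨ sum-cong-≋ {suc n} (λ k → split (toℕ k)) ⟩
        ∑[ k ≤ n ] (h (toℕ k) + g (toℕ k))
          ≈⟨ ∑-distrib-+ {suc n} (h ∘ toℕ) (g ∘ toℕ) ⟩
        ∑[ k ≤ n ] h (toℕ k) + ∑[ k ≤ n ] g (toℕ k)
          ≈⟨ +-congˡ (+-identityʳ _) ⟨
        ∑[ k ≤ n ] h (toℕ k) + (∑[ k ≤ n ] g (toℕ k) + 0#)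
          ≈⟨ +-congˡ (+-congˡ g-last) ⟨
        ∑[ k ≤ n ] h (toℕ k) + (∑[ k ≤ n ] g (toℕ k) + g (suc n))
          ≈⟨ +-congˡ (sum-last n g) ⟨
        ∑[ k ≤ n ] h (toℕ k) + (g 0 + ∑[ k ≤ n ] g (suc (toℕ k)))
          ≈⟨ +-assoc _ _ _ ⟨
        ∑[ k ≤ n ] h (toℕ k) + g 0 + ∑[ k ≤ n ] g (suc (toℕ k))
          ≈⟨ +-congʳ (+-comm _ _) ⟩
        g 0 + ∑[ k ≤ n ] h (toℕ k) + ∑[ k ≤ n ] g (suc (toℕ k))
          ≈⟨ +-assoc _ _ _ ⟩
        g 0 + (∑[ k ≤ n ] h (toℕ k) + ∑[ k ≤ n ] g (suc (toℕ k)))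
          ≈⟨ +-congˡ (∑-distrib-+ {suc n} (h ∘ toℕ) (g ∘ suc ∘ toℕ)) ⟨
        g 0 + ∑[ k ≤ n ] (h (toℕ k) + g (suc (toℕ k)))
          ≈⟨ +-congˡ (sum-cong-≋ {suc n} (λ k → distribʳ (f (suc (toℕ k))) (S n (toℕ k))
               ((fromℕ (suc (toℕ k)) - μ) * S n (suc (toℕ k))))) ⟨
        ∑[ k ≤ suc n ] (S (suc n) (toℕ k) * f (toℕ k)) ∎

    expand : IsDegenerateStirling₂ λ′ S
    expand zero    x = sym (trans (+-identityʳ (1# * 1#)) (*-identityʳ 1#))
    expand (suc n) x = trans (*-congʳ (expand n x)) (step n x)

  degenerateBernoulli-exists :
    ∀ λ′ p (-1≤p : -1ℤ ℤ.≤ p) → ∃[ β ] IsDegenerateBernoulli λ′ p -1≤p β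
  degenerateBernoulli-exists λ′ p -1≤p = (λ n → b n * fromℕ (n !)) , λ n →
    let n!⁻¹ , _ , inverseʳ = #⇒invertible (fromℕ#0 (n !) {{n ℕ.!≢0}}) in begin
      b n                              ≈⟨ *-identityʳ (b n) ⟨
      b n * 1#                         ≈⟨ *-congˡ inverseʳ ⟨
      b n * ((fromℕ (n !) - 0#) * n!⁻¹)  ≈⟨ *-congˡ (*-congʳ (x-0≈x (fromℕ (n !)))) ⟩
      b n * (fromℕ (n !) * n!⁻¹)       ≈⟨ *-assoc _ _ _ ⟨
      b n * fromℕ (n !) * n!⁻¹         ∎
    where
    b = compose (₂F₁ (1# - λ′) 1# (fromℤ (p ℤ.+ + 2)) (p+2+i#0 -1≤p)) (1-e λ′) (1-e-constant λ′)

open Reals public using (ℝ; ℝ-heytingField; ℝ-characteristicZero)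
open DegenerateNumbers ℝ-heytingField ℝ-characteristicZero public

{-# OPTIONS --safe #-}
module Submission where

-- Put g = 1 - e_λ(t).  From (1 + λt) g′ = g - 1 one gets
-- (1 + λt) (gᵏ⁺¹)′ = (k + 1) (gᵏ⁺¹ - gᵏ), so n! [tⁿ] gᵏ satisfies the triangular
-- recurrence of (-1)ᵏ k! S₂(n,k) and is equal to it.  As ⟨1⟩ₖ = k!,
-- ⟨p+2⟩ₖ = k! (p+k+1 choose p+1) and (-1)ᵏ ⟨1-λ⟩ₖ = λᵏ (1)_{k+1,1/λ}, the claim is
-- obtained by comparing coefficients of tⁿ in the definition of β.

open import Algebra.Apartness.Bundles using (HeytingField)
open import Algebra.Bundles using (CommutativeRing)
import Algebra.Apartness.Properties.HeytingCommutativeRing as HeytingProperties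
import Algebra.Properties.Ring as RingProperties
import Algebra.Properties.Semiring.Mult as SemiringMult
import Algebra.Properties.Semiring.Sum as SemiringSum
import Algebra.Solver.Ring.NaturalCoefficients.Default as SemiringSolver
open import Data.Fin.Base using (Fin; zero; suc; toℕ)
import Data.Fin.Properties as Fin
open import Data.Integer.Base as ℤ using (ℤ; +_; -[1+_]; -1ℤ) renaming (_≤_ to _≤ℤ_)
open import Data.Nat.Base as ℕ using (ℕ; zero; suc; _!; _∸_)
open import Data.Nat.Combinatorics using (_C_; nCk≡n!/k![n-k]!; k![n∸k]!∣n!)
open import Data.Nat.DivMod using (m/n*n≡m)
import Data.Nat.Properties as ℕ
open import Data.Product.Base using (Σ-syntax; _×_; _,_; proj₁; proj₂)
open import Function.Base using (_∘_)
open import Relation.Binary.PropositionalEquality as ≡ using (_≡_)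
import Relation.Binary.Reasoning.Setoid as SetoidReasoning

import Defs

-- Binomial coefficients and the shifted index q = p + 1.

[q+k]C[q]*q!*k!≡[q+k]! : ∀ q k → ((q ℕ.+ k) C q) ℕ.* (q ! ℕ.* k !) ≡ (q ℕ.+ k) !
[q+k]C[q]*q!*k!≡[q+k]! q k = begin
  ((q ℕ.+ k) C q) ℕ.* (q ! ℕ.* k !)
    ≡⟨ ≡.cong (λ j → ((q ℕ.+ k) C q) ℕ.* (q ! ℕ.* j !)) (ℕ.m+n∸m≡n q k) ⟨
  ((q ℕ.+ k) C q) ℕ.* (q ! ℕ.* (q ℕ.+ k ∸ q) !)
    ≡⟨ ≡.cong (ℕ._* (q ! ℕ.* (q ℕ.+ k ∸ q) !)) (nCk≡n!/k![n-k]! q≤q+k) ⟩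
  ((q ℕ.+ k) ! ℕ./ (q ! ℕ.* (q ℕ.+ k ∸ q) !)) ℕ.* (q ! ℕ.* (q ℕ.+ k ∸ q) !)
    ≡⟨ m/n*n≡m (k![n∸k]!∣n! q≤q+k) ⟩
  (q ℕ.+ k) !  ∎
  where
  open ≡.≡-Reasoning
  q≤q+k = ℕ.m≤m+n q k
  instance _ = q ℕ.!* (q ℕ.+ k ∸ q) !≢0

-- With q = p + 1 the integer parameter becomes a natural number: p + 2 is q + 1, the binomial
-- coefficient is (q+k choose q), and p = -1 is the case q = 0.
shift-index : ∀ {p} → -1ℤ ≤ℤ p →
              Σ[ q ∈ ℕ ] (p ℤ.+ + 2 ≡ + suc q) × (∀ k → Defs.binomial p k ≡ (q ℕ.+ k) C q)
shift-index { + m }          _ = suc m , ≡.cong +_ (ℕ.+-comm m 2) , λ k →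
  ≡.cong₂ _C_ (ℕ.+-comm (m ℕ.+ k) 1) (ℕ.+-comm m 1)
-- The sum `-1ℤ + + k` computes only once k is zero or a successor, hence the case split.
shift-index { -[1+ zero ] }  _ = 0 , ≡.refl , λ { zero → ≡.refl ; (suc k) → ≡.cong (_C 0) (ℕ.+-comm k 1) }
shift-index { -[1+ suc n ] } (ℤ.-≤- ())

module DegenerateProperties
  {c ℓ₁ ℓ₂} (F : HeytingField c ℓ₁ ℓ₂) (char0 : Defs.CharacteristicZero F) where

  open Defs.DegenerateNumbers F char0 hiding (zero)
  open HeytingProperties (HeytingField.heytingCommutativeRing F) using (x-0≈x)
  open RingProperties ring using (+-cancelʳ; -‿distribˡ-*; -1*x≈-x; -‿+-comm)
  open SemiringMult semiring using (×1-homo-*; ×-congˡ; ×-homo-+)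
  open SemiringSum semiring using (sum-cong-≋; ∑-distrib-+; *-distribˡ-sum; sum-replicate-zero)
  open SemiringSolver (CommutativeRing.commutativeSemiring commutativeRing)
    using (solve; _:=_; _:+_; _:*_; con)
  open SetoidReasoning setoid

  -- Division and cancellation in the field.

  /-cancelˡ : ∀ {x y} (y#0 : y # 0#) → y * (x / y [ y#0 ]) ≈ x
  /-cancelˡ {x} {y} y#0 = begin
    y * (x * y⁻¹)     ≈⟨ solve 3 (λ x y z → y :* (x :* z) := x :* (y :* z)) refl x y y⁻¹ ⟩
    x * (y * y⁻¹)     ≈⟨ *-congˡ (*-congʳ (x-0≈x y)) ⟨
    x * ((y - 0#) * y⁻¹)  ≈⟨ *-congˡ (proj₂ (proj₂ (#⇒invertible y#0))) ⟩
    x * 1#            ≈⟨ *-identityʳ x ⟩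
    x                 ∎
    where y⁻¹ = proj₁ (#⇒invertible y#0)

  *-cancelˡ : ∀ {x y z} → y # 0# → y * x ≈ y * z → x ≈ z
  *-cancelˡ {x} {y} {z} y#0 yx≈yz = begin
    x                        ≈⟨ lemma x ⟨
    y * x / y [ y#0 ]        ≈⟨ *-congʳ yx≈yz ⟩
    y * z / y [ y#0 ]        ≈⟨ lemma z ⟩
    z                        ∎
    where
    lemma : ∀ w → y * w / y [ y#0 ] ≈ w
    lemma w = trans (*-assoc y w _) (/-cancelˡ y#0)

  [x-y]+y≈x : ∀ x y → (x - y) + y ≈ x
  [x-y]+y≈x x y = trans (+-assoc x (- y) y) (trans (+-congˡ (-‿inverseˡ y)) (+-identityʳ x))

  fromℕ-* : ∀ m n → fromℕ (m ℕ.* n) ≈ fromℕ m * fromℕ n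
  fromℕ-* = ×1-homo-*

  -- Falling factorials and uniqueness of the degenerate Stirling numbers.

  falling-cong : ∀ μ {x y} n → x ≈ y → falling μ x n ≈ falling μ y n
  falling-cong μ zero    x≈y = refl
  falling-cong μ (suc n) x≈y = *-cong (falling-cong μ n x≈y) (+-congʳ x≈y)

  -- The definition splits off the last factor. Evaluation at 0 and the passage from x = m + 1 to x
  -- = m need the first factor instead.
  falling-suc : ∀ μ x n → falling μ x (suc n) ≈ x * falling μ (x - μ) n
  falling-suc μ x zero = begin
    1# * (x - 0# * μ)  ≈⟨ *-identityˡ _ ⟩
    x - 0# * μ         ≈⟨ +-congˡ (-‿cong (zeroˡ μ)) ⟩
    x - 0#             ≈⟨ x-0≈x x ⟩
    x                  ≈⟨ *-identityʳ x ⟨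
    x * 1#             ∎
  falling-suc μ x (suc n) = begin
    falling μ x (suc n) * (x - (1# + fromℕ n) * μ)
      ≈⟨ *-cong (falling-suc μ x n) x-[n+1]μ ⟩
    x * falling μ (x - μ) n * (x - μ - fromℕ n * μ)
      ≈⟨ *-assoc _ _ _ ⟩
    x * falling μ (x - μ) (suc n) ∎
    where
    x-[n+1]μ : x - (1# + fromℕ n) * μ ≈ x - μ - fromℕ n * μ
    x-[n+1]μ = begin
      x - (1# + fromℕ n) * μ      ≈⟨ +-congˡ (-‿cong (distribʳ μ 1# (fromℕ n))) ⟩
      x - (1# * μ + fromℕ n * μ)  ≈⟨ +-congˡ (-‿cong (+-congʳ (*-identityˡ μ))) ⟩
      x - (μ + fromℕ n * μ)       ≈⟨ +-congˡ (-‿+-comm μ (fromℕ n * μ)) ⟨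
      x + (- μ - fromℕ n * μ)     ≈⟨ +-assoc x (- μ) _ ⟨
      x - μ - fromℕ n * μ         ∎

  falling-0-suc : ∀ μ n → falling μ 0# (suc n) ≈ 0#
  falling-0-suc μ n = trans (falling-suc μ 0# n) (zeroˡ _)

  falling-fromℕ-suc : ∀ m n → falling 1# (fromℕ (suc m)) (suc n) ≈ fromℕ (suc m) * falling 1# (fromℕ m) n
  falling-fromℕ-suc m n = trans (falling-suc 1# _ n) (*-congˡ (falling-cong 1# n [1+m]-1≈m))
    where
    [1+m]-1≈m : fromℕ (suc m) - 1# ≈ fromℕ m
    [1+m]-1≈m = begin
      1# + fromℕ m - 1#    ≈⟨ +-congʳ (+-comm 1# (fromℕ m)) ⟩
      fromℕ m + 1# - 1#    ≈⟨ +-assoc _ _ _ ⟩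
      fromℕ m + (1# - 1#)  ≈⟨ +-congˡ (-‿inverseʳ 1#) ⟩
      fromℕ m + 0#         ≈⟨ +-identityʳ _ ⟩
      fromℕ m              ∎

  -- Evaluation at 0 gives the constant coefficients; dividing the rest by x = m + 1
  -- gives the same hypothesis at m for the remaining coefficients.
  falling-independent : ∀ {N} (a b : Fin N → Carrier) →
    (∀ m → ∑[ k < N ] (a k * falling 1# (fromℕ m) (toℕ k)) ≈
           ∑[ k < N ] (b k * falling 1# (fromℕ m) (toℕ k))) →
    ∀ k → a k ≈ b k
  falling-independent {suc N} a b eq = λ where
      zero    → head
      (suc k) → falling-independent (a ∘ suc) (b ∘ suc) eq-tail k
    where
    at-0 : ∀ (d : Fin (suc N) → Carrier) →
           ∑[ k ≤ N ] (d k * falling 1# (fromℕ 0) (toℕ k)) ≈ d zero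
    at-0 d = begin
      d zero * 1# + ∑[ k < N ] (d (suc k) * falling 1# 0# (suc (toℕ k)))
        ≈⟨ +-cong (*-identityʳ (d zero)) (sum-cong-≋ {N} λ k →
             trans (*-congˡ (falling-0-suc 1# (toℕ k))) (zeroʳ (d (suc k)))) ⟩
      d zero + ∑[ k < N ] 0#  ≈⟨ +-congˡ (sum-replicate-zero N) ⟩
      d zero + 0#             ≈⟨ +-identityʳ (d zero) ⟩
      d zero                  ∎

    head : a zero ≈ b zero
    head = trans (sym (at-0 a)) (trans (eq 0) (at-0 b))

    at-suc : ∀ (d : Fin (suc N) → Carrier) m →
             ∑[ k ≤ N ] (d k * falling 1# (fromℕ (suc m)) (toℕ k)) ≈
             fromℕ (suc m) * ∑[ k < N ] (d (suc k) * falling 1# (fromℕ m) (toℕ k)) + d zero * 1#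
    at-suc d m = begin
      d zero * 1# + ∑[ k < N ] (d (suc k) * falling 1# (fromℕ (suc m)) (suc (toℕ k)))
        ≈⟨ +-comm _ _ ⟩
      ∑[ k < N ] (d (suc k) * falling 1# (fromℕ (suc m)) (suc (toℕ k))) + d zero * 1#
        ≈⟨ +-congʳ (sum-cong-≋ {N} λ k → trans (*-congˡ (falling-fromℕ-suc m (toℕ k)))
             (solve 3 (λ x y z → x :* (y :* z) := y :* (x :* z)) refl
               (d (suc k)) (fromℕ (suc m)) (falling 1# (fromℕ m) (toℕ k)))) ⟩
      ∑[ k < N ] (fromℕ (suc m) * (d (suc k) * falling 1# (fromℕ m) (toℕ k))) + d zero * 1#
        ≈⟨ +-congʳ (*-distribˡ-sum {N} (fromℕ (suc m)) _) ⟨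
      fromℕ (suc m) * ∑[ k < N ] (d (suc k) * falling 1# (fromℕ m) (toℕ k)) + d zero * 1# ∎

    eq-tail : ∀ m → ∑[ k < N ] (a (suc k) * falling 1# (fromℕ m) (toℕ k)) ≈
                    ∑[ k < N ] (b (suc k) * falling 1# (fromℕ m) (toℕ k))
    eq-tail m = *-cancelˡ (fromℕ#0 (suc m)) (+-cancelʳ (b zero * 1#) _ _ (begin
      _ + b zero * 1#  ≈⟨ +-congˡ (*-congʳ head) ⟨
      _ + a zero * 1#  ≈⟨ at-suc a m ⟨
      _                ≈⟨ eq (suc m) ⟩
      _                ≈⟨ at-suc b m ⟩
      _ + b zero * 1#  ∎))

  -- Comparing at natural numbers suffices: in characteristic zero every m + 1 can be divided out,
  -- so these points already separate the falling factorials. The index is a `Fin (suc n)` because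
  -- entries with k > n are not determined.
  stirling₂-unique : ∀ {λ′} S S′ → IsDegenerateStirling₂ λ′ S → IsDegenerateStirling₂ λ′ S′ →
                     ∀ n (k : Fin (suc n)) → S n (toℕ k) ≈ S′ n (toℕ k)
  stirling₂-unique S S′ isS isS′ n = falling-independent (S n ∘ toℕ) (S′ n ∘ toℕ)
    λ m → trans (sym (isS n (fromℕ m))) (isS′ n (fromℕ m))

  -- Cauchy products and linear combinations of series.

  -- A single shape for `δ f`, for `δ g` and for `δ` of the powers of g, so that linearity of the
  -- product in each argument applies to all of them.
  linear : Carrier → Series → Carrier → Series → Series
  linear a f b g n = a * f n + b * g n

  *ₛ-cong : ∀ {f f′ g g′} → f ≈ₛ f′ → g ≈ₛ g′ → f *ₛ g ≈ₛ f′ *ₛ g′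
  *ₛ-cong f≈f′ g≈g′ n = sum-cong-≋ {suc n} λ k → *-cong (f≈f′ (toℕ k)) (g≈g′ (n ∸ toℕ k))

  *ₛ-identityˡ : ∀ f → 1ₛ *ₛ f ≈ₛ f
  *ₛ-identityˡ f n = begin
    1# * f n + ∑[ k < n ] (0# * f (n ∸ suc (toℕ k)))
      ≈⟨ +-cong (*-identityˡ (f n)) (sum-cong-≋ {n} λ k → zeroˡ (f (n ∸ suc (toℕ k)))) ⟩
    f n + ∑[ k < n ] 0#  ≈⟨ +-congˡ (sum-replicate-zero n) ⟩
    f n + 0#             ≈⟨ +-identityʳ (f n) ⟩
    f n                  ∎

  sum-linear : ∀ {N} a (x : Fin N → Carrier) b (y : Fin N → Carrier) →
               ∑[ i < N ] (a * x i + b * y i) ≈ a * ∑[ i < N ] x i + b * ∑[ i < N ] y i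
  sum-linear a x b y = trans (∑-distrib-+ (λ i → a * x i) (λ i → b * y i))
    (sym (+-cong (*-distribˡ-sum a x) (*-distribˡ-sum b y)))

  *ₛ-linearˡ : ∀ a f b g h → linear a f b g *ₛ h ≈ₛ linear a (f *ₛ h) b (g *ₛ h)
  *ₛ-linearˡ a f b g h n = trans
    (sum-cong-≋ {suc n} λ k →
      solve 5 (λ a f b g h → (a :* f :+ b :* g) :* h := a :* (f :* h) :+ b :* (g :* h)) refl
        a (f (toℕ k)) b (g (toℕ k)) (h (n ∸ toℕ k)))
    (sum-linear {suc n} a (λ k → f (toℕ k) * h (n ∸ toℕ k)) b (λ k → g (toℕ k) * h (n ∸ toℕ k)))

  *ₛ-linearʳ : ∀ a f b g h → h *ₛ linear a f b g ≈ₛ linear a (h *ₛ f) b (h *ₛ g)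
  *ₛ-linearʳ a f b g h n = trans
    (sum-cong-≋ {suc n} λ k →
      solve 5 (λ a f b g h → h :* (a :* f :+ b :* g) := a :* (h :* f) :+ b :* (h :* g)) refl
        a (f (n ∸ toℕ k)) b (g (n ∸ toℕ k)) (h (toℕ k)))
    (sum-linear {suc n} a (λ k → h (toℕ k) * f (n ∸ toℕ k)) b (λ k → h (toℕ k) * g (n ∸ toℕ k)))

  -- Derivations on formal power series.

  -- θ = t d/dt
  θ derivative : Series → Series
  θ f n          = fromℕ n * f n
  derivative f n = fromℕ (suc n) * f (suc n)

  -- In the term of index k the factor n splits as k + (n - k), one summand for each factor of the
  -- product.
  θ-leibniz : ∀ f g n → θ (f *ₛ g) n ≈ (θ f *ₛ g) n + (f *ₛ θ g) n
  θ-leibniz f g n = begin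
    fromℕ n * ∑[ k ≤ n ] (f (toℕ k) * g (n ∸ toℕ k))
      ≈⟨ *-distribˡ-sum {suc n} (fromℕ n) (λ k → f (toℕ k) * g (n ∸ toℕ k)) ⟩
    ∑[ k ≤ n ] (fromℕ n * (f (toℕ k) * g (n ∸ toℕ k)))
      ≈⟨ sum-cong-≋ {suc n} term ⟩
    ∑[ k ≤ n ] (θ f (toℕ k) * g (n ∸ toℕ k) + f (toℕ k) * θ g (n ∸ toℕ k))
      ≈⟨ ∑-distrib-+ {suc n} (λ k → θ f (toℕ k) * g (n ∸ toℕ k))
                             (λ k → f (toℕ k) * θ g (n ∸ toℕ k)) ⟩
    (θ f *ₛ g) n + (f *ₛ θ g) n ∎
    where
    term : ∀ (k : Fin (suc n)) → fromℕ n * (f (toℕ k) * g (n ∸ toℕ k)) ≈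
           θ f (toℕ k) * g (n ∸ toℕ k) + f (toℕ k) * θ g (n ∸ toℕ k)
    term k = trans
      (*-congʳ (trans (×-congˡ (≡.sym (ℕ.m+[n∸m]≡n (Fin.toℕ≤pred[n] k))))
                      (×-homo-+ 1# (toℕ k) (n ∸ toℕ k))))
      (solve 4 (λ i j x y → (i :+ j) :* (x :* y) := i :* x :* y :+ x :* (j :* y)) refl
        (fromℕ (toℕ k)) (fromℕ (n ∸ toℕ k)) (f (toℕ k)) (g (n ∸ toℕ k)))

  -- The term k = 0 vanishes with the constant term of θ f; the remaining sum is the right-hand side
  -- by computation.
  θ*-shift : ∀ f g n → (θ f *ₛ g) (suc n) ≈ (derivative f *ₛ g) n
  θ*-shift f g n = begin
    0# * f 0 * g (suc n) + (derivative f *ₛ g) n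
      ≈⟨ +-congʳ (trans (*-congʳ (zeroˡ (f 0))) (zeroˡ (g (suc n)))) ⟩
    0# + (derivative f *ₛ g) n                    ≈⟨ +-identityˡ _ ⟩
    (derivative f *ₛ g) n                         ∎

  -- Here the vanishing term is the last one, which the sum reveals only after an induction that
  -- shifts f.
  *θ-shift : ∀ f g n → (f *ₛ θ g) (suc n) ≈ (f *ₛ derivative g) n
  *θ-shift f g zero = +-congˡ (begin
    f 1 * (0# * g 0) + 0#  ≈⟨ +-identityʳ _ ⟩
    f 1 * (0# * g 0)       ≈⟨ *-congˡ (zeroˡ (g 0)) ⟩
    f 1 * 0#               ≈⟨ zeroʳ (f 1) ⟩
    0#                     ∎)
  *θ-shift f g (suc n) = +-congˡ (*θ-shift (f ∘ suc) g n)

  -- `derivative f n` is `θ f (suc n)` by definition, so this is the product rule for θ read one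
  -- degree higher.
  derivative-leibniz : ∀ f g n → derivative (f *ₛ g) n ≈ (derivative f *ₛ g) n + (f *ₛ derivative g) n
  derivative-leibniz f g n =
    trans (θ-leibniz f g (suc n)) (+-cong (θ*-shift f g n) (*θ-shift f g n))

  n!*egf : ∀ a n → fromℕ (n !) * egf a n ≈ a n
  n!*egf a n = /-cancelˡ (fromℕ#0 (n !) {{n ℕ.!≢0}})

  [-1]^k*k! : ℕ → Carrier
  [-1]^k*k! zero    = 1#
  [-1]^k*k! (suc k) = - fromℕ (suc k) * [-1]^k*k! k

  -- The operator (1 + λt) d/dt and the powers of g = 1 - e_λ(t).

  module _ (λ′ : Carrier) where

    -- δ f = (1 + λt) f′
    δ : Series → Series
    δ f = linear 1# (derivative f) λ′ (θ f)

    -- `δ` is a linear combination of the two derivations d/dt and t d/dt.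
    δ-leibniz : ∀ f g n → δ (f *ₛ g) n ≈ (δ f *ₛ g) n + (f *ₛ δ g) n
    δ-leibniz f g n = begin
      1# * derivative (f *ₛ g) n + λ′ * θ (f *ₛ g) n
        ≈⟨ +-cong (*-congˡ (derivative-leibniz f g n)) (*-congˡ (θ-leibniz f g n)) ⟩
      1# * ((derivative f *ₛ g) n + (f *ₛ derivative g) n) + λ′ * ((θ f *ₛ g) n + (f *ₛ θ g) n)
        ≈⟨ solve 6 (λ o l a b c d → o :* (a :+ b) :+ l :* (c :+ d) :=
                                    (o :* a :+ l :* c) :+ (o :* b :+ l :* d)) refl
             1# λ′ _ _ _ _ ⟩
      linear 1# (derivative f *ₛ g) λ′ (θ f *ₛ g) n + linear 1# (f *ₛ derivative g) λ′ (f *ₛ θ g) n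
        ≈⟨ +-cong (*ₛ-linearˡ 1# (derivative f) λ′ (θ f) g n) (*ₛ-linearʳ 1# (derivative g) λ′ (θ g) f n) ⟨
      (δ f *ₛ g) n + (f *ₛ δ g) n ∎

    δ-1ₛ : ∀ n → δ 1ₛ n ≈ 0#
    δ-1ₛ n = begin
      1# * (fromℕ (suc n) * 0#) + λ′ * (fromℕ n * 1ₛ n)
        ≈⟨ +-cong (trans (*-congˡ (zeroʳ _)) (zeroʳ _)) (trans (*-congˡ (n*1ₛ n)) (zeroʳ λ′)) ⟩
      0# + 0#  ≈⟨ +-identityʳ 0# ⟩
      0#       ∎
      where
      n*1ₛ : ∀ n → fromℕ n * 1ₛ n ≈ 0#
      n*1ₛ zero    = zeroˡ 1#
      n*1ₛ (suc n) = zeroʳ _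

    private
      e g : Series
      e = degenerateExp λ′ 1#
      g = 1-e λ′

    -- Multiplied by n!, the coefficient of tⁿ on the left is (1)_{n+1,λ} + nλ (1)_{n,λ}, and the
    -- last factor of (1)_{n+1,λ} is 1 - nλ.
    δ-e : δ e ≈ₛ e
    δ-e n = *-cancelˡ (fromℕ#0 (n !) {{n ℕ.!≢0}}) (begin
      fromℕ (n !) * (1# * (fromℕ (suc n) * e (suc n)) + λ′ * (fromℕ n * e n))
        ≈⟨ solve 6 (λ f s x l m y → f :* (con 1 :* (s :* x) :+ l :* (m :* y)) :=
                                    (s :* f) :* x :+ m :* l :* (f :* y)) refl
             (fromℕ (n !)) (fromℕ (suc n)) (e (suc n)) λ′ (fromℕ n) (e n) ⟩
      fromℕ (suc n) * fromℕ (n !) * e (suc n) + fromℕ n * λ′ * (fromℕ (n !) * e n)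
        ≈⟨ +-cong (*-congʳ (sym (fromℕ-* (suc n) (n !)))) (*-congˡ (n!*egf (falling λ′ 1#) n)) ⟩
      fromℕ (suc n !) * e (suc n) + fromℕ n * λ′ * falling λ′ 1# n
        ≈⟨ +-cong (n!*egf (falling λ′ 1#) (suc n)) (*-comm _ _) ⟩
      falling λ′ 1# n * (1# - fromℕ n * λ′) + falling λ′ 1# n * (fromℕ n * λ′)
        ≈⟨ distribˡ _ _ _ ⟨
      falling λ′ 1# n * (1# - fromℕ n * λ′ + fromℕ n * λ′)
        ≈⟨ *-congˡ ([x-y]+y≈x 1# (fromℕ n * λ′)) ⟩
      falling λ′ 1# n * 1#                    ≈⟨ *-identityʳ _ ⟩
      falling λ′ 1# n                         ≈⟨ n!*egf (falling λ′ 1#) n ⟨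
      fromℕ (n !) * e n                       ∎)

    -- Since g + e = 1 and δ 1 = 0, one has δ g = -δ e = -e = g - 1.
    δ-g : δ g ≈ₛ linear 1# g (- 1#) 1ₛ
    -- Adding `δ e` to both sides leaves a rearrangement without subtraction, which a semiring
    -- solver can settle.
    δ-g n = +-cancelʳ (δ e n) _ _ (begin
      δ g n + δ e n
        ≈⟨ solve 8 (λ o s l m x y u v →
             (o :* (s :* x) :+ l :* (m :* y)) :+ (o :* (s :* u) :+ l :* (m :* v)) :=
             o :* (s :* (x :+ u)) :+ l :* (m :* (y :+ v))) refl
             1# (fromℕ (suc n)) λ′ (fromℕ n) (g (suc n)) (g n) (e (suc n)) (e n) ⟩
      1# * (fromℕ (suc n) * (g (suc n) + e (suc n))) + λ′ * (fromℕ n * (g n + e n))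
        ≈⟨ +-cong (*-congˡ (*-congˡ (g+e (suc n)))) (*-congˡ (*-congˡ (g+e n))) ⟩
      δ 1ₛ n                            ≈⟨ δ-1ₛ n ⟩
      0#                                ≈⟨ -‿inverseˡ (1ₛ n) ⟨
      - 1ₛ n + 1ₛ n                     ≈⟨ +-cong (-1*x≈-x (1ₛ n)) (g+e n) ⟨
      - 1# * 1ₛ n + (g n + e n)
        ≈⟨ solve 3 (λ x y z → x :+ (y :+ z) := con 1 :* y :+ x :+ z) refl _ (g n) (e n) ⟩
      1# * g n + - 1# * 1ₛ n + e n      ≈⟨ +-congˡ (δ-e n) ⟨
      1# * g n + - 1# * 1ₛ n + δ e n    ∎)
      where
      g+e : ∀ n → g n + e n ≈ 1ₛ n
      g+e n = [x-y]+y≈x (1ₛ n) (e n)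

    -- The extra factor g avoids gᵏ⁻¹, so that k = 0 needs no separate formula. For a successor it
    -- is g times `δ-g^`, with which it is proved by mutual induction.
    g*δ-g^ : ∀ k → g *ₛ δ (g ^ₛ k) ≈ₛ linear (fromℕ k) (g ^ₛ suc k) (- fromℕ k) (g ^ₛ k)
    -- Product rule for g · gᵏ: the first summand gives gᵏ⁺¹ - gᵏ, the second k times the same
    -- difference.
    δ-g^ : ∀ k → δ (g ^ₛ suc k) ≈ₛ linear (fromℕ (suc k)) (g ^ₛ suc k) (- fromℕ (suc k)) (g ^ₛ k)

    g*δ-g^ zero n = begin
      ∑[ k ≤ n ] (g (toℕ k) * δ 1ₛ (n ∸ toℕ k))
        ≈⟨ sum-cong-≋ {suc n} (λ k → trans (*-congˡ {g (toℕ k)} (δ-1ₛ (n ∸ toℕ k))) (zeroʳ (g (toℕ k)))) ⟩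
      ∑[ k ≤ n ] 0#                            ≈⟨ sum-replicate-zero (suc n) ⟩
      0#                                       ≈⟨ +-identityˡ 0# ⟨
      0# + 0#                                  ≈⟨ +-cong (zeroˡ _) (trans (*-congʳ -0≈0) (zeroˡ _)) ⟨
      0# * (g *ₛ 1ₛ) n + - 0# * 1ₛ n           ∎
      where
      -0≈0 : - 0# ≈ 0#
      -0≈0 = trans (sym (+-identityˡ (- 0#))) (-‿inverseʳ 0#)
    g*δ-g^ (suc k) n = trans
      (*ₛ-cong {g} (λ _ → refl) (δ-g^ k) n)
      (*ₛ-linearʳ (fromℕ (suc k)) (g ^ₛ suc k) (- fromℕ (suc k)) (g ^ₛ k) g n)

    δ-g^ k n = begin
      δ (g *ₛ g ^ₛ k) n
        ≈⟨ δ-leibniz g (g ^ₛ k) n ⟩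
      (δ g *ₛ g ^ₛ k) n + (g *ₛ δ (g ^ₛ k)) n
        ≈⟨ +-cong (trans (*ₛ-cong {g = g ^ₛ k} δ-g (λ _ → refl) n) (*ₛ-linearˡ 1# g (- 1#) 1ₛ (g ^ₛ k) n))
                  (g*δ-g^ k n) ⟩
      1# * (g ^ₛ suc k) n + - 1# * (1ₛ *ₛ g ^ₛ k) n + (fromℕ k * (g ^ₛ suc k) n + - fromℕ k * (g ^ₛ k) n)
        ≈⟨ +-congʳ (+-congˡ (*-congˡ (*ₛ-identityˡ (g ^ₛ k) n))) ⟩
      1# * (g ^ₛ suc k) n + - 1# * (g ^ₛ k) n + (fromℕ k * (g ^ₛ suc k) n + - fromℕ k * (g ^ₛ k) n)
        ≈⟨ solve 6 (λ o m k -k x y → o :* x :+ m :* y :+ (k :* x :+ -k :* y) :=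
                                     (o :+ k) :* x :+ (m :+ -k) :* y) refl
             1# (- 1#) (fromℕ k) (- fromℕ k) _ _ ⟩
      fromℕ (suc k) * (g ^ₛ suc k) n + (- 1# - fromℕ k) * (g ^ₛ k) n
        ≈⟨ +-congˡ (*-congʳ (-‿+-comm 1# (fromℕ k))) ⟩
      fromℕ (suc k) * (g ^ₛ suc k) n + - fromℕ (suc k) * (g ^ₛ k) n ∎

    -- The triangular recurrence for n! [tⁿ] gᵏ.

    private
      -- The explicit solution, whose recurrence holds by computation; an arbitrary solution is
      -- reached from it by uniqueness.
      S₂ : ℕ → ℕ → Carrier
      S₂ = proj₁ (degenerateStirling₂-exists λ′)

    -- The recurrence makes this the product of 0 - jλ over j ≤ n, whose factor at j = 0 vanishes.
    S₂-suc-0 : ∀ n → S₂ (suc n) 0 ≈ 0#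
    S₂-suc-0 zero    = begin
      (0# - 0# * λ′) * 1#  ≈⟨ *-identityʳ _ ⟩
      0# - 0# * λ′         ≈⟨ +-congˡ (-‿cong (zeroˡ λ′)) ⟩
      0# - 0#              ≈⟨ -‿inverseʳ 0# ⟩
      0#                   ∎
    S₂-suc-0 (suc n) = trans (*-congˡ (S₂-suc-0 n)) (zeroʳ _)

    -- This is n! times the coefficient of tⁿ in `δ-g^`, solved for the coefficient of degree n + 1.
    n!*g^-suc : ∀ n k → fromℕ (suc n !) * (g ^ₛ suc k) (suc n) ≈
      (fromℕ (suc k) - fromℕ n * λ′) * (fromℕ (n !) * (g ^ₛ suc k) n)
        + - fromℕ (suc k) * (fromℕ (n !) * (g ^ₛ k) n)
    -- The added term is the contribution of λt d/dt; it completes the left side to n! times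
    -- `δ (g ^ₛ suc k) n`.
    n!*g^-suc n k = +-cancelʳ (fromℕ n * λ′ * (fromℕ (n !) * (g ^ₛ suc k) n)) _ _ (begin
      fromℕ (suc n !) * (g ^ₛ suc k) (suc n) + fromℕ n * λ′ * (fromℕ (n !) * (g ^ₛ suc k) n)
        ≈⟨ +-congʳ (*-congʳ (fromℕ-* (suc n) (n !))) ⟩
      fromℕ (suc n) * fromℕ (n !) * (g ^ₛ suc k) (suc n) + fromℕ n * λ′ * (fromℕ (n !) * (g ^ₛ suc k) n)
        ≈⟨ solve 6 (λ f s x l m y → f :* (con 1 :* (s :* x) :+ l :* (m :* y)) :=
                                    (s :* f) :* x :+ m :* l :* (f :* y)) refl
             (fromℕ (n !)) (fromℕ (suc n)) _ λ′ (fromℕ n) _ ⟨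
      fromℕ (n !) * δ (g ^ₛ suc k) n
        ≈⟨ *-congˡ (δ-g^ k n) ⟩
      fromℕ (n !) * (fromℕ (suc k) * (g ^ₛ suc k) n + - fromℕ (suc k) * (g ^ₛ k) n)
        ≈⟨ *-congˡ (+-congʳ (*-congʳ ([x-y]+y≈x (fromℕ (suc k)) (fromℕ n * λ′)))) ⟨
      fromℕ (n !) * ((fromℕ (suc k) - fromℕ n * λ′ + fromℕ n * λ′) * (g ^ₛ suc k) n
        + - fromℕ (suc k) * (g ^ₛ k) n)
        ≈⟨ solve 6 (λ f d m x s y → f :* ((d :+ m) :* x :+ s :* y) :=
                      (d :* (f :* x) :+ s :* (f :* y)) :+ m :* (f :* x)) refl
             (fromℕ (n !)) (fromℕ (suc k) - fromℕ n * λ′) (fromℕ n * λ′) _ (- fromℕ (suc k)) _ ⟩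
      _ ∎)

    -- Both sides obey one recurrence with equal boundary values: the coefficient -(k+1) of gᵏ is
    -- the factor that turns (-1)ᵏ k! into (-1)ᵏ⁺¹ (k+1)!.
    n!*g^≈S₂ : ∀ n k → fromℕ (n !) * (g ^ₛ k) n ≈ [-1]^k*k! k * S₂ n k
    n!*g^≈S₂ zero    zero    = *-congʳ (+-identityʳ 1#)
    n!*g^≈S₂ zero    (suc k) = begin
      fromℕ 1 * (g 0 * (g ^ₛ k) 0 + 0#)  ≈⟨ *-congˡ (trans (+-identityʳ _) (*-congʳ (1-e-constant λ′))) ⟩
      fromℕ 1 * (0# * (g ^ₛ k) 0)        ≈⟨ *-congˡ (zeroˡ _) ⟩
      fromℕ 1 * 0#                       ≈⟨ zeroʳ _ ⟩
      0#                                 ≈⟨ zeroʳ _ ⟨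
      [-1]^k*k! (suc k) * 0#             ∎
    n!*g^≈S₂ (suc n) zero    = begin
      fromℕ (suc n !) * 0#   ≈⟨ zeroʳ _ ⟩
      0#                     ≈⟨ S₂-suc-0 n ⟨
      S₂ (suc n) 0           ≈⟨ *-identityˡ _ ⟨
      1# * S₂ (suc n) 0      ∎
    n!*g^≈S₂ (suc n) (suc k) = begin
      fromℕ (suc n !) * (g ^ₛ suc k) (suc n)
        ≈⟨ n!*g^-suc n k ⟩
      d * (fromℕ (n !) * (g ^ₛ suc k) n) + - fromℕ (suc k) * (fromℕ (n !) * (g ^ₛ k) n)
        ≈⟨ +-cong (*-congˡ (n!*g^≈S₂ n (suc k))) (*-congˡ (n!*g^≈S₂ n k)) ⟩
      d * (- fromℕ (suc k) * [-1]^k*k! k * S₂ n (suc k)) + - fromℕ (suc k) * ([-1]^k*k! k * S₂ n k)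
        ≈⟨ solve 5 (λ d m s x y → d :* (m :* s :* x) :+ m :* (s :* y) := m :* s :* (y :+ d :* x)) refl
             d (- fromℕ (suc k)) ([-1]^k*k! k) _ _ ⟩
      [-1]^k*k! (suc k) * S₂ (suc n) (suc k) ∎
      where d = fromℕ (suc k) - fromℕ n * λ′

    n!*g^≈S : ∀ S → IsDegenerateStirling₂ λ′ S → ∀ n (k : Fin (suc n)) →
              fromℕ (n !) * (g ^ₛ toℕ k) n ≈ [-1]^k*k! (toℕ k) * S n (toℕ k)
    n!*g^≈S S isS n k = trans (n!*g^≈S₂ n (toℕ k))
      (*-congˡ (stirling₂-unique S₂ S (proj₂ (degenerateStirling₂-exists λ′)) isS n k))

    -- The factors of the hypergeometric coefficients.

    -- Factor by factor, -(1 - λ + k) = λ (1 - (k+1)/λ). The falling factorial has one factor more,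
    -- its first, which is 1 - 0/λ = 1.
    [-1]^k*k!*rising : (λ#0 : λ′ # 0#) → ∀ k → [-1]^k*k! k * rising (1# - λ′) k ≈
      fromℕ (k !) * (λ′ ^ k * falling (1# / λ′ [ λ#0 ]) 1# (suc k))
    [-1]^k*k!*rising λ#0 zero = *-cong (sym (+-identityʳ 1#)) (begin
      1#                       ≈⟨ x-0≈x 1# ⟨
      1# - 0#                  ≈⟨ +-congˡ (-‿cong (zeroˡ _)) ⟨
      1# - 0# * (1# / λ′ [ λ#0 ])
        ≈⟨ trans (*-identityˡ _) (*-identityˡ _) ⟨
      1# * (1# * (1# - 0# * (1# / λ′ [ λ#0 ])))  ∎)
    [-1]^k*k!*rising λ#0 (suc k) = begin
      - fromℕ (suc k) * [-1]^k*k! k * (rising (1# - λ′) k * (1# - λ′ + fromℕ k))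
        -- The sign is isolated as a factor -1, which the solver then attaches to 1 - λ + k.
        ≈⟨ *-congʳ (-‿distribˡ-* _ _) ⟨
      - (fromℕ (suc k) * [-1]^k*k! k) * (rising (1# - λ′) k * (1# - λ′ + fromℕ k))
        ≈⟨ *-congʳ (-1*x≈-x _) ⟨
      - 1# * (fromℕ (suc k) * [-1]^k*k! k) * (rising (1# - λ′) k * (1# - λ′ + fromℕ k))
        ≈⟨ solve 5 (λ o s t r u → o :* (s :* t) :* (r :* u) := s :* (t :* r) :* (o :* u)) refl
             (- 1#) (fromℕ (suc k)) ([-1]^k*k! k) (rising (1# - λ′) k) (1# - λ′ + fromℕ k) ⟩
      fromℕ (suc k) * ([-1]^k*k! k * rising (1# - λ′) k) * (- 1# * (1# - λ′ + fromℕ k))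
        ≈⟨ *-cong (*-congˡ ([-1]^k*k!*rising λ#0 k)) sign ⟩
      fromℕ (suc k) * (fromℕ (k !) * (λ′ ^ k * φ)) * (λ′ * (1# - fromℕ (suc k) * λ⁻¹))
        ≈⟨ solve 6 (λ s f p φ l u → s :* (f :* (p :* φ)) :* (l :* u) :=
                                    s :* f :* (l :* p :* (φ :* u))) refl
             (fromℕ (suc k)) (fromℕ (k !)) (λ′ ^ k) φ λ′ _ ⟩
      fromℕ (suc k) * fromℕ (k !) * (λ′ ^ suc k * (φ * (1# - fromℕ (suc k) * λ⁻¹)))
        ≈⟨ *-congʳ (fromℕ-* (suc k) (k !)) ⟨
      fromℕ (suc k !) * (λ′ ^ suc k * (φ * (1# - fromℕ (suc k) * λ⁻¹))) ∎
      where
      λ⁻¹ = 1# / λ′ [ λ#0 ]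
      φ   = falling λ⁻¹ 1# (suc k)

      sign : - 1# * (1# - λ′ + fromℕ k) ≈ λ′ * (1# - fromℕ (suc k) * λ⁻¹)
      -- After k + 1 is added, both sides equal λ.
      sign = +-cancelʳ (fromℕ (suc k)) _ _ (begin
        - 1# * (1# - λ′ + fromℕ k) + fromℕ (suc k)
          ≈⟨ +-congˡ (+-congʳ ([x-y]+y≈x 1# λ′)) ⟨
        - 1# * (1# - λ′ + fromℕ k) + (1# - λ′ + λ′ + fromℕ k)
          ≈⟨ +-cong (-1*x≈-x _) (solve 3 (λ x l k → x :+ l :+ k := (x :+ k) :+ l) refl (1# - λ′) λ′ (fromℕ k)) ⟩
        - (1# - λ′ + fromℕ k) + ((1# - λ′ + fromℕ k) + λ′)
          ≈⟨ +-assoc _ _ _ ⟨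
        - (1# - λ′ + fromℕ k) + (1# - λ′ + fromℕ k) + λ′
          ≈⟨ trans (+-congʳ (-‿inverseˡ _)) (+-identityˡ λ′) ⟩
        λ′
          ≈⟨ *-identityʳ λ′ ⟨
        λ′ * 1#
          ≈⟨ *-congˡ ([x-y]+y≈x 1# (fromℕ (suc k) * λ⁻¹)) ⟨
        λ′ * (1# - fromℕ (suc k) * λ⁻¹ + fromℕ (suc k) * λ⁻¹)
          ≈⟨ solve 4 (λ l u s i → l :* (u :+ s :* i) := l :* u :+ s :* (l :* i)) refl
               λ′ _ (fromℕ (suc k)) λ⁻¹ ⟩
        λ′ * (1# - fromℕ (suc k) * λ⁻¹) + fromℕ (suc k) * (λ′ * λ⁻¹)
          ≈⟨ +-congˡ (trans (*-congˡ (/-cancelˡ λ#0)) (*-identityʳ _)) ⟩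
        λ′ * (1# - fromℕ (suc k) * λ⁻¹) + fromℕ (suc k) ∎)

  rising-cong : ∀ {a b} k → a ≈ b → rising a k ≈ rising b k
  rising-cong zero    a≈b = refl
  rising-cong (suc k) a≈b = *-cong (rising-cong k a≈b) (+-congʳ a≈b)

  -- The product (q+1)(q+2)...(q+k) continues q!.
  q!*rising : ∀ q k → fromℕ (q !) * rising (fromℕ (suc q)) k ≈ fromℕ ((q ℕ.+ k) !)
  q!*rising q zero    = trans (*-identityʳ _) (×-congˡ (≡.cong _! (≡.sym (ℕ.+-identityʳ q))))
  q!*rising q (suc k) = begin
    fromℕ (q !) * (rising (fromℕ (suc q)) k * (fromℕ (suc q) + fromℕ k))
      ≈⟨ *-assoc _ _ _ ⟨
    fromℕ (q !) * rising (fromℕ (suc q)) k * (fromℕ (suc q) + fromℕ k)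
      ≈⟨ *-cong (q!*rising q k) (sym (×-homo-+ 1# (suc q) k)) ⟩
    fromℕ ((q ℕ.+ k) !) * fromℕ (suc (q ℕ.+ k))
      ≈⟨ *-comm _ _ ⟩
    fromℕ (suc (q ℕ.+ k)) * fromℕ ((q ℕ.+ k) !)
      ≈⟨ fromℕ-* (suc (q ℕ.+ k)) ((q ℕ.+ k) !) ⟨
    fromℕ (suc (q ℕ.+ k) !)
      ≈⟨ ×-congˡ (≡.cong _! (≡.sym (ℕ.+-suc q k))) ⟩
    fromℕ ((q ℕ.+ suc k) !) ∎

  -- Both sides become (q+k)! on multiplication by q!, which is invertible in characteristic zero.
  rising-fromℕ : ∀ q k → rising (fromℕ (suc q)) k ≈ fromℕ ((q ℕ.+ k) C q) * fromℕ (k !)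
  rising-fromℕ q k = *-cancelˡ (fromℕ#0 (q !) {{q ℕ.!≢0}}) (begin
    fromℕ (q !) * rising (fromℕ (suc q)) k
      ≈⟨ q!*rising q k ⟩
    fromℕ ((q ℕ.+ k) !)
      ≈⟨ ×-congˡ (≡.sym ([q+k]C[q]*q!*k!≡[q+k]! q k)) ⟩
    fromℕ (((q ℕ.+ k) C q) ℕ.* (q ! ℕ.* k !))
      ≈⟨ trans (fromℕ-* ((q ℕ.+ k) C q) (q ! ℕ.* k !)) (*-congˡ (fromℕ-* (q !) (k !))) ⟩
    fromℕ ((q ℕ.+ k) C q) * (fromℕ (q !) * fromℕ (k !))
      ≈⟨ solve 3 (λ x y z → x :* (y :* z) := y :* (x :* z)) refl _ _ _ ⟩
    fromℕ (q !) * (fromℕ ((q ℕ.+ k) C q) * fromℕ (k !)) ∎)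

  rising-1 : ∀ k → rising 1# k ≈ fromℕ (k !)
  rising-1 k = begin
    rising 1# k                    ≈⟨ *-identityˡ _ ⟨
    -- `fromℕ 1` computes to `1# + 0#`; the claim is the case q = 0 of `q!*rising`.
    1# * rising 1# k               ≈⟨ *-cong (+-identityʳ 1#) (rising-cong k (+-identityʳ 1#)) ⟨
    fromℕ 1 * rising (fromℕ 1) k   ≈⟨ q!*rising 0 k ⟩
    fromℕ (k !)                    ∎

  rising-p+2 : ∀ {p} → -1ℤ ≤ℤ p → ∀ k →
               rising (fromℤ (p ℤ.+ + 2)) k ≈ fromℕ (Defs.binomial p k) * fromℕ (k !)
  rising-p+2 {p} -1≤p k with shift-index -1≤p
  ... | q , p+2≡1+q , binomial≡ = begin
    rising (fromℤ (p ℤ.+ + 2)) k             ≈⟨ rising-cong k (reflexive (≡.cong fromℤ p+2≡1+q)) ⟩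
    rising (fromℕ (suc q)) k                 ≈⟨ rising-fromℕ q k ⟩
    fromℕ ((q ℕ.+ k) C q) * fromℕ (k !)      ≈⟨ *-congʳ (×-congˡ (binomial≡ k)) ⟨
    fromℕ (Defs.binomial p k) * fromℕ (k !)  ∎

  -- Comparison of coefficients.

  module _ {λ′ : Carrier} (λ#0 : λ′ # 0#) {p : ℤ} (-1≤p : -1ℤ ≤ℤ p) where

    hypergeometric : Series
    hypergeometric = ₂F₁ (1# - λ′) 1# (fromℤ (p ℤ.+ + 2)) (p+2+i#0 -1≤p)

    weight : ℕ → Carrier
    weight k = λ′ ^ k * falling (1# / λ′ [ λ#0 ]) 1# (suc k)
      / fromℕ (Defs.binomial p k) [ fromℕ#0 (Defs.binomial p k) {{Defs.binomial-nonZero -1≤p k}} ]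

    hypergeometric*[-1]^k*k! : ∀ k → hypergeometric k * [-1]^k*k! k ≈ weight k
    hypergeometric*[-1]^k*k! k =
      -- All denominators are cleared: one k! cancels the k! of the series, the other joins the
      -- binomial coefficient to form ⟨p+2⟩ₖ. On the left two factors k! reappear, from ⟨1⟩ₖ and
      -- from `[-1]^k*k!*rising`.
      *-cancelˡ b#0 (*-cancelˡ f#0 (*-cancelˡ f#0 (begin
      f * (f * (b * (h * s)))
        ≈⟨ solve 4 (λ f b h s → f :* (f :* (b :* (h :* s))) := (b :* f) :* (f :* h) :* s) refl f b h s ⟩
      (b * f) * (f * h) * s
        ≈⟨ *-congʳ (*-cong (sym (rising-p+2 -1≤p k)) (/-cancelˡ f#0)) ⟩
      r * (rising (1# - λ′) k * rising 1# k / r [ r#0 ]) * s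
        ≈⟨ *-congʳ (/-cancelˡ r#0) ⟩
      rising (1# - λ′) k * rising 1# k * s
        ≈⟨ *-congʳ (*-congˡ (rising-1 k)) ⟩
      rising (1# - λ′) k * f * s
        ≈⟨ solve 3 (λ x f s → x :* f :* s := f :* (s :* x)) refl (rising (1# - λ′) k) f s ⟩
      f * (s * rising (1# - λ′) k)
        ≈⟨ *-congˡ ([-1]^k*k!*rising λ′ λ#0 k) ⟩
      f * (f * (λ′ ^ k * falling (1# / λ′ [ λ#0 ]) 1# (suc k)))
        ≈⟨ *-congˡ (*-congˡ (/-cancelˡ b#0)) ⟨
      f * (f * (b * weight k)) ∎)))
      where
      f   = fromℕ (k !)
      b   = fromℕ (Defs.binomial p k)
      h   = hypergeometric k
      s   = [-1]^k*k! k
      r   = rising (fromℤ (p ℤ.+ + 2)) k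
      f#0 = fromℕ#0 (k !) {{k ℕ.!≢0}}
      b#0 = fromℕ#0 (Defs.binomial p k) {{Defs.binomial-nonZero -1≤p k}}
      r#0 = rising#0 (p+2+i#0 -1≤p) k

    -- The composition is by definition a finite sum over k ≤ n, exactly the range in which S n k is
    -- determined, so the two sums agree term by term.
    bernoulli-stirling₂ : ∀ S → IsDegenerateStirling₂ λ′ S → ∀ β → IsDegenerateBernoulli λ′ p -1≤p β →
                          ∀ n → β n ≈ ∑[ k ≤ n ] (weight (toℕ k) * S n (toℕ k))
    bernoulli-stirling₂ S isS β isβ n = begin
      β n                        ≈⟨ n!*egf β n ⟨
      fromℕ (n !) * egf β n      ≈⟨ *-congˡ (isβ n) ⟨
      fromℕ (n !) * ∑[ k ≤ n ] (hypergeometric (toℕ k) * (1-e λ′ ^ₛ toℕ k) n)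
        ≈⟨ *-distribˡ-sum {suc n} (fromℕ (n !)) (λ k → hypergeometric (toℕ k) * (1-e λ′ ^ₛ toℕ k) n) ⟩
      ∑[ k ≤ n ] (fromℕ (n !) * (hypergeometric (toℕ k) * (1-e λ′ ^ₛ toℕ k) n))
        ≈⟨ sum-cong-≋ {suc n} term ⟩
      ∑[ k ≤ n ] (weight (toℕ k) * S n (toℕ k)) ∎
      where
      term : ∀ (k : Fin (suc n)) →
             fromℕ (n !) * (hypergeometric (toℕ k) * (1-e λ′ ^ₛ toℕ k) n) ≈ weight (toℕ k) * S n (toℕ k)
      term k = begin
        fromℕ (n !) * (hypergeometric (toℕ k) * (1-e λ′ ^ₛ toℕ k) n)
          ≈⟨ solve 3 (λ x y z → x :* (y :* z) := y :* (x :* z)) refl _ _ _ ⟩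
        hypergeometric (toℕ k) * (fromℕ (n !) * (1-e λ′ ^ₛ toℕ k) n)
          ≈⟨ *-congˡ (n!*g^≈S λ′ S isS n k) ⟩
        hypergeometric (toℕ k) * ([-1]^k*k! (toℕ k) * S n (toℕ k))
          ≈⟨ *-assoc _ _ _ ⟨
        hypergeometric (toℕ k) * [-1]^k*k! (toℕ k) * S n (toℕ k)
          ≈⟨ *-congʳ (hypergeometric*[-1]^k*k! (toℕ k)) ⟩
        weight (toℕ k) * S n (toℕ k) ∎

-- Specialisation to the real numbers.

open import Defs

theorem3 : (λ′ : ℝ) (λ#0 : λ′ # 0#) (p : ℤ) (-1≤p : -1ℤ ≤ℤ p)
    (S : ℕ → ℕ → ℝ) → IsDegenerateStirling₂ λ′ S →
    (β : ℕ → ℝ) → IsDegenerateBernoulli λ′ p -1≤p β →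
    ∀ n → β n ≈ ∑[ k ≤ n ]
    (λ′ ^ toℕ k * falling (1# / λ′ [ λ#0 ]) 1# (suc (toℕ k))
    / fromℕ (binomial p (toℕ k)) [ fromℕ#0 (binomial p (toℕ k)) {{binomial-nonZero -1≤p (toℕ k)}} ]
    * S n (toℕ k))
theorem3 λ′ λ#0 p -1≤p S isS β isβ =
  DegenerateProperties.bernoulli-stirling₂ ℝ-heytingField ℝ-characteristicZero λ#0 -1≤p S isS β isβ
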